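{- Let $\alpha\in\mathbb{R}\setminus\mathbb{Q}$ and $\beta>0$. Let $g:\mathbb{R}^+\to\mathbb{R}^+$ satisfy $g(t)=t^{\beta}+o(t^{\beta})$ as $t\to+\infty$. Let $F:\mathbb{R}\to\mathbb{R}$ be a continuous $1$-periodic function with only isolated roots such that for every root $r\in\mathbb{R}$ of $F$ there exist $\gamma(r)>0$ and $c_r\in\mathbb{R}\setminus\{0\}$ with $$F(r+x)=c_r\cdot\epsilon(x)\cdot|x|^{\gamma(r)}+o\left(|x|^{\gamma(r)}\right)\quad\text{as }x\to0 .$$ If there exists a root $r\in\mathbb{R}$ of $F$ such that $\frac{\beta}{\gamma(r)}\in(0,1)$, then the sequence $\left(g(k)\cdot F(k\alpha)\right)_{k\in\mathbb{N}}$ is dense in $\mathbb{R}$.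
   Context: $\mathbb{N}=\{1,2,3,\dots\}$; $\mathbb{R}^+$ is the set of positive reals. The sign function is $\epsilon(x)=1$ if $x>0$, $\epsilon(0)=0$, $\epsilon(x)=-1$ if $x<0$. -}

module Defs where

open import Algebra.Bundles using (CommutativeRing; Semiring)
import Algebra.Definitions.RawSemiring as RawSemiringDefinitions
open import Axiom.ExcludedMiddle using (ExcludedMiddle)
open import Data.Integer.Base using (ℤ; +_; -[1+_])
open import Data.Nat.Base using (ℕ; zero; suc; NonZero)
open import Data.Product.Base using (∃; _×_; _,_; proj₁; proj₂)
open import Data.Rational.Base using (ℚ; ↥_; ↧ₙ_)
open import Function.Bundles using (Func)
open import Level using (0ℓ) renaming (suc to lsuc)
open import Relation.Binary.Bundles using (Setoid)
import Relation.Binary.Construct.On as On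
import Relation.Binary.Construct.StrictToNonStrict as StrictToNonStrict
open import Relation.Binary.Core using (Rel)
open import Relation.Binary.Definitions using (tri<; tri≈; tri>)
open import Relation.Binary.Structures using (IsStrictTotalOrder)
open import Relation.Nullary.Decidable.Core using (yes; no)
open import Relation.Unary using (Pred)

-- The Dedekind-complete ordered field axioms, which classically characterise
-- ℝ up to unique isomorphism.  Trichotomy, provided by IsStrictTotalOrder, is
-- the classical one.

record CompleteOrderedField : Set (lsuc 0ℓ) where
  infix 4 _<_
  field
    commutativeRing : CommutativeRing 0ℓ 0ℓ

  open CommutativeRing commutativeRing public

  field
    _<_                : Rel Carrier 0ℓ
    isStrictTotalOrder : IsStrictTotalOrder _≈_ _<_
    0<1                : 0# < 1#
    +-monoˡ-<          : ∀ z {x y} → x < y → x + z < y + z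
    *-pos              : ∀ {x y} → 0# < x → 0# < y → 0# < x * y
    inverse            : ∀ x → x ≉ 0# → ∃ λ y → x * y ≈ 1#

  open IsStrictTotalOrder isStrictTotalOrder public
    using (compare; _≟_; _<?_; <-resp-≈; <-respˡ-≈; <-respʳ-≈)
    renaming (trans to <-trans; irrefl to <-irrefl; asym to <-asym)

  open StrictToNonStrict _≈_ _<_ public using (_≤_)

  UpperBound : Pred Carrier 0ℓ → Pred Carrier 0ℓ
  UpperBound P u = ∀ x → P x → x ≤ u

  IsSupremum : Pred Carrier 0ℓ → Pred Carrier 0ℓ
  IsSupremum P s = UpperBound P s × (∀ u → UpperBound P u → s ≤ u)

  field
    complete : ∀ P → ∃ P → ∃ (UpperBound P) → ∃ (IsSupremum P)

ℕ⁺ : Set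
ℕ⁺ = ∃ NonZero

module RealAnalysis (em : ExcludedMiddle 0ℓ) (ℝ : CompleteOrderedField) where

  open CompleteOrderedField ℝ public
  open RawSemiringDefinitions (Semiring.rawSemiring semiring) public
    using (_^_) renaming (_×_ to _×ₙ_)

  infix  9 _⁻¹
  infixl 7 _/_
  infixr 8 _^ℤ_ _^ʳ_

  -- Reciprocal, with the value 0# at 0#.
  _⁻¹ : Carrier → Carrier
  x ⁻¹ with x ≟ 0#
  ... | yes _  = 0#
  ... | no x≉0 = proj₁ (inverse x x≉0)

  _/_ : Carrier → Carrier → Carrier
  x / y = x * y ⁻¹

  ∣_∣ : Carrier → Carrier
  ∣ x ∣ with compare x 0#
  ... | tri< _ _ _ = - x
  ... | tri≈ _ _ _ = 0#
  ... | tri> _ _ _ = x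

  sgn : Carrier → Carrier
  sgn x with compare x 0#
  ... | tri< _ _ _ = - 1#
  ... | tri≈ _ _ _ = 0#
  ... | tri> _ _ _ = 1#

  fromℕ : ℕ → Carrier
  fromℕ n = n ×ₙ 1#

  fromℤ : ℤ → Carrier
  fromℤ (+ n)    = fromℕ n
  fromℤ -[1+ n ] = - fromℕ (suc n)

  fromℚ : ℚ → Carrier
  fromℚ q = fromℤ (↥ q) / fromℕ (↧ₙ q)

  Irrational : Pred Carrier 0ℓ
  Irrational x = ∀ q → x ≉ fromℚ q

  -- Supremum, with the value 0# when P is empty or unbounded above.
  sup : Pred Carrier 0ℓ → Carrier
  sup P with em {∃ P × ∃ (UpperBound P)}
  ... | yes (inhabited , bounded) = proj₁ (complete P inhabited bounded)
  ... | no _                      = 0#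

  _^ℤ_ : Carrier → ℤ → Carrier
  x ^ℤ (+ n)    = x ^ n
  x ^ℤ -[1+ n ] = (x ^ suc n) ⁻¹

  -- For positive x: y = x^q, i.e. y is the positive n-th root of x^m, where
  -- q = m/n in lowest terms.
  IsRationalPower : Carrier → ℚ → Carrier → Set
  IsRationalPower x q y = 0# < y × y ^ ↧ₙ q ≈ x ^ℤ ↥ q

  -- x^a for x ≥ 1, as sup { x^q : q rational, q ≤ a }.
  pow≥1 : Carrier → Carrier → Carrier
  pow≥1 x a = sup λ y → ∃ λ q → fromℚ q ≤ a × IsRationalPower x q y

  -- Real power of a positive base, using x^a = 1/(1/x)^a for 0 < x < 1.
  -- Nonpositive bases are given the value 0#.
  _^ʳ_ : Carrier → Carrier → Carrier
  x ^ʳ a with 0# <? x | x <? 1#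
  ... | no  _ | _     = 0#
  ... | yes _ | yes _ = pow≥1 (x ⁻¹) a ⁻¹
  ... | yes _ | no  _ = pow≥1 x a

  ℝ⁺ : Setoid 0ℓ 0ℓ
  ℝ⁺ = On.setoid {B = ∃ (0# <_)} setoid proj₁

  fromℕ-pos : ∀ n → 0# < fromℕ (suc n)
  fromℕ-pos zero    = <-respʳ-≈ (sym (+-identityʳ 1#)) 0<1
  fromℕ-pos (suc n) = <-trans (fromℕ-pos n)
    (<-respˡ-≈ (+-identityˡ _) (+-monoˡ-< (fromℕ (suc n)) 0<1))

  fromℕ⁺ : ℕ⁺ → Setoid.Carrier ℝ⁺
  fromℕ⁺ (suc n , _) = fromℕ (suc n) , fromℕ-pos n

  infixl 10 _⟨_⟩ _⟨_⟩⁺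

  _⟨_⟩ : Func setoid setoid → Carrier → Carrier
  F ⟨ x ⟩ = Func.to F x

  _⟨_⟩⁺ : Func ℝ⁺ ℝ⁺ → Setoid.Carrier ℝ⁺ → Carrier
  g ⟨ t ⟩⁺ = proj₁ (Func.to g t)

  infix 4 _=o[t→+∞]_ _=o[x→0]_

  _=o[t→+∞]_ : (f h : Setoid.Carrier ℝ⁺ → Carrier) → Set
  f =o[t→+∞] h = ∀ δ → 0# < δ → ∃ λ T →
    ∀ t → T < proj₁ t → ∣ f t ∣ ≤ δ * ∣ h t ∣

  _=o[x→0]_ : (f h : Carrier → Carrier) → Set
  f =o[x→0] h = ∀ δ → 0# < δ → ∃ λ η → 0# < η ×
    (∀ x → 0# < ∣ x ∣ → ∣ x ∣ < η → ∣ f x ∣ ≤ δ * ∣ h x ∣)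

  Continuous : Func setoid setoid → Set
  Continuous F = ∀ x δ → 0# < δ → ∃ λ η → 0# < η ×
    (∀ y → ∣ y - x ∣ < η → ∣ F ⟨ y ⟩ - F ⟨ x ⟩ ∣ < δ)

  1-Periodic : Func setoid setoid → Set
  1-Periodic F = ∀ x → F ⟨ x + 1# ⟩ ≈ F ⟨ x ⟩

  Root : Func setoid setoid → Pred Carrier 0ℓ
  Root F r = F ⟨ r ⟩ ≈ 0#

  OnlyIsolatedRoots : Func setoid setoid → Set
  OnlyIsolatedRoots F = ∀ r → Root F r → ∃ λ η → 0# < η ×
    (∀ x → Root F x → ∣ x - r ∣ < η → x ≈ r)

  Dense : {I : Set} → (I → Carrier) → Set
  Dense a = ∀ y δ → 0# < δ → ∃ λ i → ∣ a i - y ∣ < δ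

{-# OPTIONS --safe #-}

-- Only kα close to r modulo 1 matter.  Writing kα = r + x + m with m an integer,
-- g(k) F(kα) is close to c sgn(x) k^β |x|^γ, so a target y ≠ 0 asks for the right
-- sign of x and for |x|^(-γ) ≈ (|c| / |y|) k^β.  If p/q is a convergent of α and N
-- is fixed, then kα with Nq ≤ k < (N + 1)q comes within 2/q of every point of the
-- circle, and for N large k^β is almost constant over this range of k.  The
-- required |x| is then of order q^(-β/γ), which dominates 1/q because β < γ, so some
-- k hits it up to a factor close to 1.
--
-- As |x|^γ is the reciprocal of (1/|x|)^γ, real powers are only needed for bases at
-- least 1, where t = x^a is characterised by comparing x^m with t^n for natural m and
-- n.  This is symmetric under exchanging x and t and inverting a, which is how
-- equations X^γ = V are solved.

module Submission where

open import Defs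
open import Axiom.ExcludedMiddle using (ExcludedMiddle)
open import Data.Product.Base using (∃; _×_; _,_; proj₁; proj₂)
open import Function.Bundles using (Func)
open import Level using (0ℓ)
open import Algebra.Bundles using (RawRing)
import Algebra.Properties.AbelianGroup as AbelianGroupProperties
import Algebra.Properties.CommutativeSemiring.Exp as ExpProperties
import Algebra.Properties.Monoid.Mult.TCOptimised as MultTCProperties
import Algebra.Properties.Ring as RingProperties
import Algebra.Properties.Semiring.Mult as MultProperties
import Algebra.Solver.Ring as RingSolver
open import Algebra.Solver.Ring.AlmostCommutativeRing using (fromCommutativeRing; _-Raw-AlmostCommutative⟶_)
open import Data.Integer.Base as ℤ using (ℤ; +_; -[1+_]; _⊖_)
import Data.Integer.DivMod as ℤ
import Data.Integer.Properties as ℤ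
import Data.Integer.Solver as ℤSolver
open import Data.Maybe.Base using (Maybe; just; nothing)
open import Data.Nat.Base as ℕ using (ℕ; zero; suc)
import Data.Nat.GCD as ℕ
import Data.Nat.Properties as ℕ
open import Data.Rational.Base as ℚ using (ℚ; mkℚ; ↥_; ↧ₙ_)
import Data.Rational.Properties as ℚ
open import Data.Sum.Base using (_⊎_; inj₁; inj₂; [_,_]′)
open import Relation.Binary.Bundles using (DecTotalOrder; StrictTotalOrder)
open import Relation.Binary.Definitions using (Tri; tri<; tri≈; tri>)
import Relation.Binary.Properties.StrictTotalOrder as StrictTotalOrderProperties
import Relation.Binary.PropositionalEquality as ≡
open ≡ using (_≡_)
import Relation.Binary.Reasoning.StrictPartialOrder as StrictPartialOrderReasoning
open import Relation.Nullary using (¬_; yes; no; contradiction)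
open import Relation.Unary using (Pred)

-- The obstacle is circular: k determines x, but the size wanted for x depends on k through kᵝ. So
-- the wanted size is computed once, from (N q)ᵝ at the start of the block, and only afterwards is k
-- sought inside the block. The estimates on powers are multiplicative ("within a factor τ"): the
-- asymptotics of g and F give relative errors, and real powers, being suprema of rational ones,
-- come without logarithms. The precision δ fixes a relative precision ε and τ = 1 + ε. The factor τ
-- is split into two factors ρ, one for the variation of k across the block and one for the error in
-- x. Continuity of the powers turns each ρ into a factor allowed on the base, σ₁ for k and σ₂ for
-- 1/∣x∣. Then σ₁ determines N, and q is chosen last, as large as everything else demands;
-- irrationality of α supplies arbitrarily large q.

module DensityProof (em : ExcludedMiddle 0ℓ) (ℝ : CompleteOrderedField) where

  open RealAnalysis em ℝ

  open AbelianGroupProperties +-abelianGroup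
    using () renaming (⁻¹-∙-comm to -‿+-comm; ε⁻¹≈ε to -0≈0; ⁻¹-involutive to -‿involutive)
  open ExpProperties commutativeSemiring
    using (^-congˡ; ^-congʳ; ^-assocʳ; ^-distrib-*)
  open RingProperties ring using (-‿distribˡ-*; -‿distribʳ-*; -1*x≈-x)

  strictTotalOrder : StrictTotalOrder 0ℓ 0ℓ 0ℓ
  strictTotalOrder = record { isStrictTotalOrder = isStrictTotalOrder }

  open StrictTotalOrder strictTotalOrder using (strictPartialOrder)
  open StrictTotalOrderProperties strictTotalOrder using ()
    renaming (decTotalOrder to ≤-decTotalOrder)
  open DecTotalOrder ≤-decTotalOrder using ()
    renaming (trans to ≤-trans; refl to ≤-refl; reflexive to ≤-reflexive; antisym to ≤-antisym; total to ≤-total)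
  open StrictPartialOrderReasoning strictPartialOrder

  -- The integers inside the field, and a ring solver with integer coefficients

  fromℕ-homo-+ : ∀ m n → fromℕ (m ℕ.+ n) ≈ fromℕ m + fromℕ n
  fromℕ-homo-+ = MultProperties.×-homo-+ semiring 1#

  fromℕ-homo-* : ∀ m n → fromℕ (m ℕ.* n) ≈ fromℕ m * fromℕ n
  fromℕ-homo-* = MultProperties.×1-homo-* semiring

  fromℤ-⊖ : ∀ m n → fromℤ (m ⊖ n) ≈ fromℕ m - fromℕ n
  fromℤ-⊖ m zero = begin-equality
    fromℕ m           ≈⟨ +-identityʳ _ ⟨
    fromℕ m + 0#      ≈⟨ +-congˡ -0≈0 ⟨
    fromℕ m - 0#      ∎
  fromℤ-⊖ zero (suc n) = sym (+-identityˡ _)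
  fromℤ-⊖ (suc m) (suc n) = begin-equality
    fromℤ (suc m ⊖ suc n)               ≡⟨ ≡.cong fromℤ (ℤ.[1+m]⊖[1+n]≡m⊖n m n) ⟩
    fromℤ (m ⊖ n)                       ≈⟨ fromℤ-⊖ m n ⟩
    fromℕ m - fromℕ n                   ≈⟨ +-congʳ (+-identityʳ _) ⟨
    fromℕ m + 0# - fromℕ n              ≈⟨ +-congʳ (+-congˡ (-‿inverseʳ 1#)) ⟨
    fromℕ m + (1# - 1#) - fromℕ n       ≈⟨ +-congʳ (+-assoc _ _ _) ⟨
    fromℕ m + 1# - 1# - fromℕ n         ≈⟨ +-assoc _ _ _ ⟩
    fromℕ m + 1# + (- 1# - fromℕ n)     ≈⟨ +-cong (+-comm _ _) (-‿+-comm _ _) ⟩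
    fromℕ (suc m) - fromℕ (suc n)       ∎

  fromℤ-homo-neg : ∀ i → fromℤ (ℤ.- i) ≈ - fromℤ i
  fromℤ-homo-neg (+ zero)  = sym -0≈0
  fromℤ-homo-neg (+ suc n) = refl
  fromℤ-homo-neg -[1+ n ]  = sym (-‿involutive _)

  fromℤ-homo-+ : ∀ i j → fromℤ (i ℤ.+ j) ≈ fromℤ i + fromℤ j
  fromℤ-homo-+ (+ m)    (+ n)    = fromℕ-homo-+ m n
  fromℤ-homo-+ (+ m)    -[1+ n ] = fromℤ-⊖ m (suc n)
  fromℤ-homo-+ -[1+ m ] (+ n)    = trans (fromℤ-⊖ n (suc m)) (+-comm _ _)
  fromℤ-homo-+ -[1+ m ] -[1+ n ] = begin-equality
    - fromℕ (suc (suc (m ℕ.+ n)))       ≡⟨ ≡.cong (λ k → - fromℕ (suc k)) (ℕ.+-suc m n) ⟨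
    - fromℕ (suc m ℕ.+ suc n)           ≈⟨ -‿cong (fromℕ-homo-+ (suc m) (suc n)) ⟩
    - (fromℕ (suc m) + fromℕ (suc n))   ≈⟨ -‿+-comm _ _ ⟨
    - fromℕ (suc m) - fromℕ (suc n)     ∎

  fromℤ-homo-* : ∀ i j → fromℤ (i ℤ.* j) ≈ fromℤ i * fromℤ j
  fromℤ-homo-* (+ m) j = +* m j
    where
    ++ : ∀ m n → fromℤ (+ m ℤ.* + n) ≈ fromℕ m * fromℕ n
    ++ m n = begin-equality
      fromℤ (+ m ℤ.* + n)   ≡⟨ ≡.cong fromℤ (ℤ.pos-* m n) ⟨
      fromℕ (m ℕ.* n)       ≈⟨ fromℕ-homo-* m n ⟩
      fromℕ m * fromℕ n     ∎
    +* : ∀ m j → fromℤ (+ m ℤ.* j) ≈ fromℕ m * fromℤ j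
    +* m (+ n)    = ++ m n
    +* m -[1+ n ] = begin-equality
      fromℤ (+ m ℤ.* -[1+ n ])        ≡⟨ ≡.cong fromℤ (ℤ.neg-distribʳ-* (+ m) (+ suc n)) ⟨
      fromℤ (ℤ.- (+ m ℤ.* + suc n))   ≈⟨ fromℤ-homo-neg (+ m ℤ.* + suc n) ⟩
      - fromℤ (+ m ℤ.* + suc n)       ≈⟨ -‿cong (++ m (suc n)) ⟩
      - (fromℕ m * fromℕ (suc n))     ≈⟨ -‿distribʳ-* _ _ ⟩
      fromℕ m * - fromℕ (suc n)       ∎
  fromℤ-homo-* -[1+ m ] j = begin-equality
    fromℤ (-[1+ m ] ℤ.* j)        ≡⟨ ≡.cong fromℤ (ℤ.neg-distribˡ-* (+ suc m) j) ⟨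
    fromℤ (ℤ.- (+ suc m ℤ.* j))   ≈⟨ fromℤ-homo-neg (+ suc m ℤ.* j) ⟩
    - fromℤ (+ suc m ℤ.* j)       ≈⟨ -‿cong (fromℤ-homo-* (+ suc m) j) ⟩
    - (fromℕ (suc m) * fromℤ j)   ≈⟨ -‿distribˡ-* _ _ ⟩
    - fromℕ (suc m) * fromℤ j     ∎

  -- The coefficients of the solver use the optimised multiple, so that the
  -- constant 1 is interpreted as 1# rather than as 1# + 0#.
  private
    ℤ-rawRing : RawRing 0ℓ 0ℓ
    ℤ-rawRing = record
      { Carrier = ℤ ; _≈_ = _≡_ ; _+_ = ℤ._+_ ; _*_ = ℤ._*_ ; -_ = ℤ.-_ ; 0# = + 0 ; 1# = + 1 }

    open MultTCProperties +-monoid using (×ᵤ≈×) renaming (_×_ to _×ᵒ_)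

    ⟦_⟧ᶜ : ℤ → Carrier
    ⟦ + n ⟧ᶜ      = n ×ᵒ 1#
    ⟦ -[1+ n ] ⟧ᶜ = - (suc n ×ᵒ 1#)

    ⟦⟧ᶜ≈fromℤ : ∀ i → ⟦ i ⟧ᶜ ≈ fromℤ i
    ⟦⟧ᶜ≈fromℤ (+ n)    = sym (×ᵤ≈× n 1#)
    ⟦⟧ᶜ≈fromℤ -[1+ n ] = -‿cong (sym (×ᵤ≈× (suc n) 1#))

    ⟦⟧ᶜ-homomorphism : ℤ-rawRing -Raw-AlmostCommutative⟶ fromCommutativeRing commutativeRing
    ⟦⟧ᶜ-homomorphism = record
      { ⟦_⟧    = ⟦_⟧ᶜ
      ; +-homo = λ i j → trans (⟦⟧ᶜ≈fromℤ (i ℤ.+ j))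
                   (trans (fromℤ-homo-+ i j) (+-cong (sym (⟦⟧ᶜ≈fromℤ i)) (sym (⟦⟧ᶜ≈fromℤ j))))
      ; *-homo = λ i j → trans (⟦⟧ᶜ≈fromℤ (i ℤ.* j))
                   (trans (fromℤ-homo-* i j) (*-cong (sym (⟦⟧ᶜ≈fromℤ i)) (sym (⟦⟧ᶜ≈fromℤ j))))
      ; -‿homo = λ i → trans (⟦⟧ᶜ≈fromℤ (ℤ.- i))
                   (trans (fromℤ-homo-neg i) (-‿cong (sym (⟦⟧ᶜ≈fromℤ i))))
      ; 0-homo = refl
      ; 1-homo = refl
      }

    coefficient≟ : ∀ i j → Maybe (⟦ i ⟧ᶜ ≈ ⟦ j ⟧ᶜ)
    coefficient≟ i j with i ℤ.≟ j
    ... | yes ≡.refl = just refl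
    ... | no _       = nothing

  open RingSolver ℤ-rawRing (fromCommutativeRing commutativeRing) ⟦⟧ᶜ-homomorphism coefficient≟
    using (solve; con; _:+_; _:*_; _:-_; :-_; _:=_; Polynomial)

  :1 : ∀ {n} → Polynomial n
  :1 = con (+ 1)

  :2 : ∀ {n} → Polynomial n
  :2 = con (+ 2)

  -- This form is definitionally the interpretation of the solver constant `:2`, so solver
  -- identities apply to it directly.
  2# : Carrier
  2# = 1# + 1#

  -- Ordered fields

  <⇒≤ : ∀ {x y} → x < y → x ≤ y
  <⇒≤ = inj₁

  ≮⇒≥ : ∀ {x y} → ¬ x < y → y ≤ x
  ≮⇒≥ {x} {y} x≮y with compare x y
  ... | tri< x<y _ _ = contradiction x<y x≮y
  ... | tri≈ _ x≈y _ = inj₂ (sym x≈y)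
  ... | tri> _ _ y<x = inj₁ y<x

  ≰⇒> : ∀ {x y} → ¬ x ≤ y → y < x
  ≰⇒> {x} {y} x≰y with compare x y
  ... | tri< x<y _ _ = contradiction (inj₁ x<y) x≰y
  ... | tri≈ _ x≈y _ = contradiction (inj₂ x≈y) x≰y
  ... | tri> _ _ y<x = y<x

  <⇒≱ : ∀ {x y} → x < y → ¬ y ≤ x
  <⇒≱ x<y (inj₁ y<x) = <-asym x<y y<x
  <⇒≱ x<y (inj₂ y≈x) = <-irrefl (sym y≈x) x<y

  <-≤-trans : ∀ {x y z} → x < y → y ≤ z → x < z
  <-≤-trans x<y (inj₁ y<z) = <-trans x<y y<z
  <-≤-trans x<y (inj₂ y≈z) = <-respʳ-≈ y≈z x<y

  ≤-<-trans : ∀ {x y z} → x ≤ y → y < z → x < z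
  ≤-<-trans (inj₁ x<y) y<z = <-trans x<y y<z
  ≤-<-trans (inj₂ x≈y) y<z = <-respˡ-≈ (sym x≈y) y<z

  -- An inequality is proved by writing the difference of its sides as a
  -- combination of quantities of known sign.
  <-by : ∀ {x y e} → 0# < e → y - x ≈ e → x < y
  <-by {x} {y} {e} 0<e eq = begin-strict
    x        ≈⟨ +-identityˡ x ⟨
    0# + x   <⟨ +-monoˡ-< x 0<e ⟩
    e + x    ≈⟨ +-congʳ eq ⟨
    y - x + x ≈⟨ solve 2 (λ x y → y :- x :+ x := y) refl x y ⟩
    y        ∎

  ≤-by : ∀ {x y e} → 0# ≤ e → y - x ≈ e → x ≤ y
  ≤-by         (inj₁ 0<e) eq = inj₁ (<-by 0<e eq)
  ≤-by {x} {y} (inj₂ 0≈e) eq = inj₂ (begin-equality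
    x          ≈⟨ +-identityˡ x ⟨
    0# + x     ≈⟨ +-congʳ 0≈e ⟩
    _ + x      ≈⟨ +-congʳ eq ⟨
    y - x + x  ≈⟨ solve 2 (λ x y → y :- x :+ x := y) refl x y ⟩
    y          ∎)

  x<y⇒0<y-x : ∀ {x y} → x < y → 0# < y - x
  x<y⇒0<y-x {x} {y} x<y = begin-strict
    0#     ≈⟨ -‿inverseʳ x ⟨
    x - x  <⟨ +-monoˡ-< (- x) x<y ⟩
    y - x  ∎

  x≤y⇒0≤y-x : ∀ {x y} → x ≤ y → 0# ≤ y - x
  x≤y⇒0≤y-x (inj₁ x<y) = inj₁ (x<y⇒0<y-x x<y)
  x≤y⇒0≤y-x {x} {y} (inj₂ x≈y) = inj₂ (trans (sym (-‿inverseʳ x)) (+-congʳ x≈y))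

  +-pos : ∀ {x y} → 0# < x → 0# < y → 0# < x + y
  +-pos {x} {y} 0<x 0<y = <-trans 0<y (<-respˡ-≈ (+-identityˡ y) (+-monoˡ-< y 0<x))

  +-monoˡ-≤ : ∀ z {x y} → x ≤ y → x + z ≤ y + z
  +-monoˡ-≤ z (inj₁ x<y) = inj₁ (+-monoˡ-< z x<y)
  +-monoˡ-≤ z (inj₂ x≈y) = inj₂ (+-congʳ x≈y)

  +-mono-≤ : ∀ {x y u v} → x ≤ y → u ≤ v → x + u ≤ y + v
  +-mono-≤ {x} {y} {u} {v} x≤y u≤v = begin
    x + u  ≤⟨ +-monoˡ-≤ u x≤y ⟩
    y + u  ≈⟨ +-comm y u ⟩
    u + y  ≤⟨ +-monoˡ-≤ y u≤v ⟩
    v + y  ≈⟨ +-comm v y ⟩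
    y + v  ∎

  +-nonneg : ∀ {x y} → 0# ≤ x → 0# ≤ y → 0# ≤ x + y
  +-nonneg 0≤x 0≤y = ≤-trans (≤-reflexive (sym (+-identityˡ 0#))) (+-mono-≤ 0≤x 0≤y)

  +-pos-nonneg : ∀ {x y} → 0# < x → 0# ≤ y → 0# < x + y
  +-pos-nonneg 0<x (inj₁ 0<y) = +-pos 0<x 0<y
  +-pos-nonneg 0<x (inj₂ 0≈y) = <-respʳ-≈ (trans (sym (+-identityʳ _)) (+-congˡ 0≈y)) 0<x

  *-nonneg : ∀ {x y} → 0# ≤ x → 0# ≤ y → 0# ≤ x * y
  *-nonneg (inj₁ 0<x) (inj₁ 0<y) = inj₁ (*-pos 0<x 0<y)
  *-nonneg (inj₁ 0<x) (inj₂ 0≈y) = inj₂ (trans (sym (zeroʳ _)) (*-congˡ 0≈y))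
  *-nonneg (inj₂ 0≈x) _          = inj₂ (trans (sym (zeroˡ _)) (*-congʳ 0≈x))

  neg-antimono-< : ∀ {x y} → x < y → - y < - x
  neg-antimono-< {x} {y} x<y = <-by (x<y⇒0<y-x x<y)
    (solve 2 (λ x y → :- x :- (:- y) := y :- x) refl x y)

  neg-antimono-≤ : ∀ {x y} → x ≤ y → - y ≤ - x
  neg-antimono-≤ {x} {y} x≤y = ≤-by (x≤y⇒0≤y-x x≤y)
    (solve 2 (λ x y → :- x :- (:- y) := y :- x) refl x y)

  neg⇒0<- : ∀ {x} → x < 0# → 0# < - x
  neg⇒0<- x<0 = <-respˡ-≈ -0≈0 (neg-antimono-< x<0)

  0≤1 : 0# ≤ 1#
  0≤1 = inj₁ 0<1

  0<2 : 0# < 2#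
  0<2 = +-pos 0<1 0<1

  0<⇒≉0 : ∀ {x} → 0# < x → x ≉ 0#
  0<⇒≉0 0<x x≈0 = <-irrefl (sym x≈0) 0<x

  *-monoʳ-< : ∀ {x y z} → 0# < z → x < y → z * x < z * y
  *-monoʳ-< {x} {y} {z} 0<z x<y = <-by (*-pos 0<z (x<y⇒0<y-x x<y))
    (solve 3 (λ x y z → z :* y :- z :* x := z :* (y :- x)) refl x y z)

  *-monoʳ-≤ : ∀ {x y z} → 0# ≤ z → x ≤ y → z * x ≤ z * y
  *-monoʳ-≤ {x} {y} {z} 0≤z x≤y = ≤-by (*-nonneg 0≤z (x≤y⇒0≤y-x x≤y))
    (solve 3 (λ x y z → z :* y :- z :* x := z :* (y :- x)) refl x y z)

  *-monoˡ-≤ : ∀ {x y z} → 0# ≤ z → x ≤ y → x * z ≤ y * z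
  *-monoˡ-≤ {x} {y} {z} 0≤z x≤y = begin
    x * z  ≈⟨ *-comm x z ⟩
    z * x  ≤⟨ *-monoʳ-≤ 0≤z x≤y ⟩
    z * y  ≈⟨ *-comm z y ⟩
    y * z  ∎

  *-monoˡ-< : ∀ {x y z} → 0# < z → x < y → x * z < y * z
  *-monoˡ-< {x} {y} {z} 0<z x<y = begin-strict
    x * z  ≈⟨ *-comm x z ⟩
    z * x  <⟨ *-monoʳ-< 0<z x<y ⟩
    z * y  ≈⟨ *-comm z y ⟩
    y * z  ∎

  *-mono-≤ : ∀ {x y u v} → 0# ≤ x → 0# ≤ u → x ≤ y → u ≤ v → x * u ≤ y * v
  *-mono-≤ 0≤x 0≤u x≤y u≤v =
    ≤-trans (*-monoˡ-≤ 0≤u x≤y) (*-monoʳ-≤ (≤-trans 0≤x x≤y) u≤v)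

  *-cancelˡ-≤ : ∀ {x y z} → 0# < z → z * x ≤ z * y → x ≤ y
  *-cancelˡ-≤ 0<z zx≤zy = ≮⇒≥ λ y<x → <⇒≱ (*-monoʳ-< 0<z y<x) zx≤zy

  *-cancelˡ-< : ∀ {x y z} → 0# < z → z * x < z * y → x < y
  *-cancelˡ-< 0<z zx<zy = ≰⇒> λ y≤x → <⇒≱ zx<zy (*-monoʳ-≤ (inj₁ 0<z) y≤x)

  *-cancelˡ-pos : ∀ {x y} → 0# < x → 0# < x * y → 0# < y
  *-cancelˡ-pos 0<x 0<xy = *-cancelˡ-< 0<x (<-respˡ-≈ (sym (zeroʳ _)) 0<xy)

  1≤⇒0< : ∀ {x} → 1# ≤ x → 0# < x
  1≤⇒0< = <-≤-trans 0<1

  1≤⇒0≤ : ∀ {x} → 1# ≤ x → 0# ≤ x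
  1≤⇒0≤ 1≤x = inj₁ (1≤⇒0< 1≤x)

  1≤* : ∀ {x y} → 1# ≤ x → 1# ≤ y → 1# ≤ x * y
  1≤* 1≤x 1≤y = ≤-trans (≤-reflexive (sym (*-identityˡ 1#))) (*-mono-≤ 0≤1 0≤1 1≤x 1≤y)

  maximum : ∀ x y → ∃ λ z → x ≤ z × y ≤ z
  maximum x y = [ (λ x≤y → y , x≤y , ≤-refl) , (λ y≤x → x , ≤-refl , y≤x) ]′ (≤-total x y)

  ⁻¹-inverseʳ : ∀ {x} → x ≉ 0# → x * x ⁻¹ ≈ 1#
  ⁻¹-inverseʳ {x} x≉0 with x ≟ 0#
  ... | yes x≈0  = contradiction x≈0 x≉0
  ... | no  x≉0′ = proj₂ (inverse x x≉0′)

  ⁻¹-unique : ∀ {x y} → x * y ≈ 1# → y ≈ x ⁻¹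
  ⁻¹-unique {x} {y} xy≈1 = begin-equality
    y               ≈⟨ *-identityʳ y ⟨
    y * 1#          ≈⟨ *-congˡ (⁻¹-inverseʳ x≉0) ⟨
    y * (x * x ⁻¹)  ≈⟨ solve 3 (λ x y z → y :* (x :* z) := x :* y :* z) refl x y (x ⁻¹) ⟩
    x * y * x ⁻¹    ≈⟨ *-congʳ xy≈1 ⟩
    1# * x ⁻¹       ≈⟨ *-identityˡ _ ⟩
    x ⁻¹            ∎
    where
    x≉0 : x ≉ 0#
    x≉0 x≈0 = <-irrefl (trans (sym (zeroˡ y)) (trans (*-congʳ (sym x≈0)) xy≈1)) 0<1

  ⁻¹-pos : ∀ {x} → 0# < x → 0# < x ⁻¹
  ⁻¹-pos {x} 0<x = *-cancelˡ-pos 0<x (<-respʳ-≈ (sym (⁻¹-inverseʳ (0<⇒≉0 0<x))) 0<1)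

  ⁻¹<1 : ∀ {x} → 1# < x → x ⁻¹ < 1#
  ⁻¹<1 {x} 1<x = *-cancelˡ-< (<-trans 0<1 1<x) (begin-strict
    x * x ⁻¹  ≈⟨ ⁻¹-inverseʳ (0<⇒≉0 (<-trans 0<1 1<x)) ⟩
    1#        <⟨ 1<x ⟩
    x         ≈⟨ *-identityʳ x ⟨
    x * 1#    ∎)

  ⁻¹-involutive : ∀ {x} → x ≉ 0# → (x ⁻¹) ⁻¹ ≈ x
  ⁻¹-involutive x≉0 = sym (⁻¹-unique (trans (*-comm _ _) (⁻¹-inverseʳ x≉0)))

  *⁻¹-cancelʳ : ∀ {x y} → 0# < y → x * y ⁻¹ * y ≈ x
  *⁻¹-cancelʳ {x} {y} 0<y = begin-equality
    x * y ⁻¹ * y    ≈⟨ solve 3 (λ x y z → x :* z :* y := x :* (y :* z)) refl x y (y ⁻¹) ⟩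
    x * (y * y ⁻¹)  ≈⟨ *-congˡ (⁻¹-inverseʳ (0<⇒≉0 0<y)) ⟩
    x * 1#          ≈⟨ *-identityʳ x ⟩
    x               ∎

  1≤⁻¹ : ∀ {x} → 0# < x → x ≤ 1# → 1# ≤ x ⁻¹
  1≤⁻¹ {x} 0<x x≤1 = *-cancelˡ-≤ 0<x (begin
    x * 1#    ≈⟨ *-identityʳ x ⟩
    x         ≤⟨ x≤1 ⟩
    1#        ≈⟨ ⁻¹-inverseʳ (0<⇒≉0 0<x) ⟨
    x * x ⁻¹  ∎)

  *-cancelʳ-≤ : ∀ {x y z} → 0# < z → x * z ≤ y * z → x ≤ y
  *-cancelʳ-≤ {x} {y} {z} 0<z xz≤yz = *-cancelˡ-≤ 0<z (begin
    z * x  ≈⟨ *-comm z x ⟩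
    x * z  ≤⟨ xz≤yz ⟩
    y * z  ≈⟨ *-comm y z ⟩
    z * y  ∎)

  *-cancelʳ-< : ∀ {x y z} → 0# < z → x * z < y * z → x < y
  *-cancelʳ-< {x} {y} {z} 0<z xz<yz = *-cancelˡ-< 0<z (begin-strict
    z * x  ≈⟨ *-comm z x ⟩
    x * z  <⟨ xz<yz ⟩
    y * z  ≈⟨ *-comm y z ⟩
    z * y  ∎)

  ≤-/ : ∀ {x y z} → 0# < y → x * y ≤ z → x ≤ z / y
  ≤-/ 0<y xy≤z = *-cancelʳ-≤ 0<y (≤-trans xy≤z (≤-reflexive (sym (*⁻¹-cancelʳ 0<y))))

  /-≤ : ∀ {x y z} → 0# < y → z ≤ x * y → z / y ≤ x
  /-≤ 0<y z≤xy = *-cancelʳ-≤ 0<y (≤-trans (≤-reflexive (*⁻¹-cancelʳ 0<y)) z≤xy)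

  <-/ : ∀ {x y z} → 0# < y → x * y < z → x < z / y
  <-/ 0<y xy<z = *-cancelʳ-< 0<y (<-respʳ-≈ (sym (*⁻¹-cancelʳ 0<y)) xy<z)

  /-< : ∀ {x y z} → 0# < y → z < x * y → z / y < x
  /-< 0<y z<xy = *-cancelʳ-< 0<y (<-respˡ-≈ (sym (*⁻¹-cancelʳ 0<y)) z<xy)

  -- Order on the naturals in the field, the Archimedean property and integer parts

  fromℕ-nonneg : ∀ n → 0# ≤ fromℕ n
  fromℕ-nonneg zero    = ≤-refl
  fromℕ-nonneg (suc n) = inj₁ (fromℕ-pos n)

  fromℕ-mono-≤ : ∀ {m n} → m ℕ.≤ n → fromℕ m ≤ fromℕ n
  fromℕ-mono-≤ {n = n} ℕ.z≤n = fromℕ-nonneg n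
  fromℕ-mono-≤ (ℕ.s≤s m≤n)   = +-mono-≤ ≤-refl (fromℕ-mono-≤ m≤n)

  fromℕ-cancel-< : ∀ {m n} → fromℕ m < fromℕ n → m ℕ.< n
  fromℕ-cancel-< m<n = ℕ.≰⇒> λ n≤m → <⇒≱ m<n (fromℕ-mono-≤ n≤m)

  x<1+x : ∀ x → x < 1# + x
  x<1+x x = <-by 0<1 (solve 1 (λ x → :1 :+ x :- x := :1) refl x)

  fromℕ-mono-< : ∀ {m n} → m ℕ.< n → fromℕ m < fromℕ n
  fromℕ-mono-< {m} m<n = <-≤-trans (x<1+x (fromℕ m)) (fromℕ-mono-≤ m<n)

  fromℕ-cancel-≤ : ∀ {m n} → fromℕ m ≤ fromℕ n → m ℕ.≤ n
  fromℕ-cancel-≤ m≤n = ℕ.≮⇒≥ λ n<m → <⇒≱ (fromℕ-mono-< n<m) m≤n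

  1≤fromℕ : ∀ {n} → 1 ℕ.≤ n → 1# ≤ fromℕ n
  1≤fromℕ 1≤n = ≤-trans (≤-reflexive (sym (+-identityʳ 1#))) (fromℕ-mono-≤ 1≤n)

  -- If the naturals were bounded, they would have a supremum s. Since n + 1 ≤ s for every n, also s
  -- - 1 would be an upper bound, contradicting minimality.
  archimedean : ∀ x → ∃ λ n → x < fromℕ n
  archimedean x with em {∃ λ n → x < fromℕ n}
  ... | yes found = found
  ... | no ¬found = contradiction sup≤sup-1 (<⇒≱ sup-1<sup)
    where
    Natural : Carrier → Set
    Natural y = ∃ λ n → y ≈ fromℕ n

    supremum : ∃ (IsSupremum Natural)
    supremum = complete Natural (0# , 0 , refl)
      (x , λ { y (n , y≈n) → ≤-trans (≤-reflexive y≈n) (≮⇒≥ λ x<n → ¬found (n , x<n)) })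

    s : Carrier
    s = proj₁ supremum

    sup-1<sup : s - 1# < s
    sup-1<sup = <-by 0<1 (solve 1 (λ s → s :- (s :- :1) := :1) refl s)

    sup≤sup-1 : s ≤ s - 1#
    sup≤sup-1 = proj₂ (proj₂ supremum) (s - 1#) λ { y (n , y≈n) →
      ≤-by (x≤y⇒0≤y-x (proj₁ (proj₂ supremum) (1# + y) (suc n , +-congˡ y≈n)))
           (solve 2 (λ s y → s :- :1 :- y := s :- (:1 :+ y)) refl s y) }

  floorℕ : ∀ {x} → 0# ≤ x → ∃ λ n → fromℕ n ≤ x × x < fromℕ (suc n)
  floorℕ {x} 0≤x = descend (proj₁ (archimedean x)) (proj₂ (archimedean x))
    where
    descend : ∀ n → x < fromℕ n → ∃ λ m → fromℕ m ≤ x × x < fromℕ (suc m)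
    descend zero    x<0 = contradiction 0≤x (<⇒≱ x<0)
    descend (suc n) x<1+n with x <? fromℕ n
    ... | yes x<n = descend n x<n
    ... | no  x≮n = n , ≮⇒≥ x≮n , x<1+n

  -- Adding a natural N > - x reduces to the nonnegative case; N is subtracted again from the
  -- result.
  floor : ∀ x → ∃ λ i → fromℤ i ≤ x × x < 1# + fromℤ i
  floor x with archimedean (- x)
  ... | N , -x<N with floorℕ {x + fromℕ N} (inj₁ (<-respʳ-≈
                        (solve 2 (λ x N → N :- (:- x) := x :+ N) refl x (fromℕ N)) (x<y⇒0<y-x -x<N)))
  ... | n , n≤x+N , x+N<1+n = + n ℤ.- + N ,
    ≤-by (x≤y⇒0≤y-x n≤x+N) (trans (+-congˡ (-‿cong n-N))
      (solve 3 (λ x n N → x :- (n :- N) := x :+ N :- n) refl x (fromℕ n) (fromℕ N))) ,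
    <-by (x<y⇒0<y-x x+N<1+n) (trans (+-congʳ (+-congˡ n-N))
      (solve 3 (λ x n N → :1 :+ (n :- N) :- x := :1 :+ n :- (x :+ N)) refl x (fromℕ n) (fromℕ N)))
    where
    n-N : fromℤ (+ n ℤ.- + N) ≈ fromℕ n - fromℕ N
    n-N = trans (fromℤ-homo-+ (+ n) (ℤ.- + N)) (+-congˡ (fromℤ-homo-neg (+ N)))

  -- Absolute value

  0≤x⇒∣x∣≈x : ∀ {x} → 0# ≤ x → ∣ x ∣ ≈ x
  0≤x⇒∣x∣≈x {x} 0≤x with compare x 0#
  ... | tri< x<0 _ _ = contradiction 0≤x (<⇒≱ x<0)
  ... | tri≈ _ x≈0 _ = sym x≈0
  ... | tri> _ _ _   = refl

  x≤0⇒∣x∣≈-x : ∀ {x} → x ≤ 0# → ∣ x ∣ ≈ - x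
  x≤0⇒∣x∣≈-x {x} x≤0 with compare x 0#
  ... | tri< _ _ _   = refl
  ... | tri≈ _ x≈0 _ = trans (sym -0≈0) (-‿cong (sym x≈0))
  ... | tri> _ _ 0<x = contradiction x≤0 (<⇒≱ 0<x)

  ∣-∣-cong : ∀ {x y} → x ≈ y → ∣ x ∣ ≈ ∣ y ∣
  ∣-∣-cong {x} {y} x≈y with ≤-total 0# x
  ... | inj₁ 0≤x = trans (0≤x⇒∣x∣≈x 0≤x) (trans x≈y (sym (0≤x⇒∣x∣≈x (≤-trans 0≤x (inj₂ x≈y)))))
  ... | inj₂ x≤0 = trans (x≤0⇒∣x∣≈-x x≤0)
    (trans (-‿cong x≈y) (sym (x≤0⇒∣x∣≈-x (≤-trans (inj₂ (sym x≈y)) x≤0))))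

  x≤∣x∣ : ∀ x → x ≤ ∣ x ∣
  x≤∣x∣ x with ≤-total 0# x
  ... | inj₁ 0≤x = inj₂ (sym (0≤x⇒∣x∣≈x 0≤x))
  ... | inj₂ x≤0 = begin
    x      ≤⟨ x≤0 ⟩
    0#     ≈⟨ -0≈0 ⟨
    - 0#   ≤⟨ neg-antimono-≤ x≤0 ⟩
    - x    ≈⟨ x≤0⇒∣x∣≈-x x≤0 ⟨
    ∣ x ∣  ∎

  ∣x∣≤ : ∀ {x b} → x ≤ b → - x ≤ b → ∣ x ∣ ≤ b
  ∣x∣≤ {x} x≤b -x≤b with ≤-total 0# x
  ... | inj₁ 0≤x = ≤-trans (inj₂ (0≤x⇒∣x∣≈x 0≤x)) x≤b
  ... | inj₂ x≤0 = ≤-trans (inj₂ (x≤0⇒∣x∣≈-x x≤0)) -x≤b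

  0≤∣x∣ : ∀ x → 0# ≤ ∣ x ∣
  0≤∣x∣ x with ≤-total 0# x
  ... | inj₁ 0≤x = ≤-trans 0≤x (x≤∣x∣ x)
  ... | inj₂ x≤0 = ≤-trans (≤-trans (inj₂ (sym -0≈0)) (neg-antimono-≤ x≤0)) (inj₂ (sym (x≤0⇒∣x∣≈-x x≤0)))

  ∣-x∣≈∣x∣ : ∀ x → ∣ - x ∣ ≈ ∣ x ∣
  ∣-x∣≈∣x∣ x with ≤-total 0# x
  ... | inj₁ 0≤x = trans (x≤0⇒∣x∣≈-x (≤-trans (neg-antimono-≤ 0≤x) (inj₂ -0≈0)))
                     (trans (-‿involutive x) (sym (0≤x⇒∣x∣≈x 0≤x)))
  ... | inj₂ x≤0 = trans (0≤x⇒∣x∣≈x (≤-trans (inj₂ (sym -0≈0)) (neg-antimono-≤ x≤0)))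
                     (sym (x≤0⇒∣x∣≈-x x≤0))

  -x≤∣x∣ : ∀ x → - x ≤ ∣ x ∣
  -x≤∣x∣ x = ≤-trans (x≤∣x∣ (- x)) (inj₂ (∣-x∣≈∣x∣ x))

  ∣x+y∣≤∣x∣+∣y∣ : ∀ x y → ∣ x + y ∣ ≤ ∣ x ∣ + ∣ y ∣
  ∣x+y∣≤∣x∣+∣y∣ x y = ∣x∣≤ (+-mono-≤ (x≤∣x∣ x) (x≤∣x∣ y))
    (≤-trans (inj₂ (sym (-‿+-comm x y))) (+-mono-≤ (-x≤∣x∣ x) (-x≤∣x∣ y)))

  ∣x*y∣≈x*∣y∣ : ∀ {x} y → 0# ≤ x → ∣ x * y ∣ ≈ x * ∣ y ∣
  ∣x*y∣≈x*∣y∣ {x} y 0≤x with ≤-total 0# y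
  ... | inj₁ 0≤y = trans (0≤x⇒∣x∣≈x (*-nonneg 0≤x 0≤y)) (*-congˡ (sym (0≤x⇒∣x∣≈x 0≤y)))
  ... | inj₂ y≤0 = begin-equality
    ∣ x * y ∣  ≈⟨ x≤0⇒∣x∣≈-x (≤-trans (*-monoʳ-≤ 0≤x y≤0) (inj₂ (zeroʳ x))) ⟩
    - (x * y)  ≈⟨ -‿distribʳ-* x y ⟩
    x * - y    ≈⟨ *-congˡ (x≤0⇒∣x∣≈-x y≤0) ⟨
    x * ∣ y ∣  ∎

  ∣x*y∣≈∣x∣*∣y∣ : ∀ x y → ∣ x * y ∣ ≈ ∣ x ∣ * ∣ y ∣
  ∣x*y∣≈∣x∣*∣y∣ x y with ≤-total 0# x
  ... | inj₁ 0≤x = trans (∣x*y∣≈x*∣y∣ y 0≤x) (*-congʳ (sym (0≤x⇒∣x∣≈x 0≤x)))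
  ... | inj₂ x≤0 = begin-equality
    ∣ x * y ∣      ≈⟨ ∣-x∣≈∣x∣ (x * y) ⟨
    ∣ - (x * y) ∣  ≈⟨ ∣-∣-cong (-‿distribˡ-* x y) ⟩
    ∣ - x * y ∣    ≈⟨ ∣x*y∣≈x*∣y∣ y (≤-trans (0≤∣x∣ x) (inj₂ (x≤0⇒∣x∣≈-x x≤0))) ⟩
    - x * ∣ y ∣    ≈⟨ *-congʳ (x≤0⇒∣x∣≈-x x≤0) ⟨
    ∣ x ∣ * ∣ y ∣  ∎

  -- Integer powers and roots

  ^-pos : ∀ {x} n → 0# < x → 0# < x ^ n
  ^-pos zero    0<x = 0<1
  ^-pos (suc n) 0<x = *-pos 0<x (^-pos n 0<x)

  1≤^ : ∀ {x} n → 1# ≤ x → 1# ≤ x ^ n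
  1≤^ zero    1≤x = ≤-refl
  1≤^ (suc n) 1≤x = 1≤* 1≤x (1≤^ n 1≤x)

  ^-nonneg : ∀ {x} n → 0# ≤ x → 0# ≤ x ^ n
  ^-nonneg zero    0≤x = 0≤1
  ^-nonneg (suc n) 0≤x = *-nonneg 0≤x (^-nonneg n 0≤x)

  ^-mono-≤ : ∀ {x y} n → 0# ≤ x → x ≤ y → x ^ n ≤ y ^ n
  ^-mono-≤ zero    0≤x x≤y = ≤-refl
  ^-mono-≤ (suc n) 0≤x x≤y = *-mono-≤ 0≤x (^-nonneg n 0≤x) x≤y (^-mono-≤ n 0≤x x≤y)

  ^-monoʳ-≤ : ∀ {x m n} → 1# ≤ x → m ℕ.≤ n → x ^ m ≤ x ^ n
  ^-monoʳ-≤ {n = n} 1≤x ℕ.z≤n   = 1≤^ n 1≤x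
  ^-monoʳ-≤ 1≤x (ℕ.s≤s m≤n) = *-monoʳ-≤ (1≤⇒0≤ 1≤x) (^-monoʳ-≤ 1≤x m≤n)

  ^-mono-< : ∀ {x y} n → 0# ≤ x → x < y → x ^ suc n < y ^ suc n
  ^-mono-< {x} {y} n 0≤x x<y = begin-strict
    x * x ^ n  ≤⟨ *-monoʳ-≤ 0≤x (^-mono-≤ n 0≤x (<⇒≤ x<y)) ⟩
    x * y ^ n  <⟨ *-monoˡ-< (^-pos n (≤-<-trans 0≤x x<y)) x<y ⟩
    y * y ^ n  ∎

  ^-cancel-≤ : ∀ {x y} n → 0# ≤ y → x ^ suc n ≤ y ^ suc n → x ≤ y
  ^-cancel-≤ n 0≤y xⁿ≤yⁿ = ≮⇒≥ λ y<x → <⇒≱ (^-mono-< n 0≤y y<x) xⁿ≤yⁿ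

  1^ : ∀ n → 1# ^ n ≈ 1#
  1^ zero    = refl
  1^ (suc n) = trans (*-identityˡ _) (1^ n)

  ^-swap : ∀ x m n → (x ^ m) ^ n ≈ (x ^ n) ^ m
  ^-swap x m n = trans (^-assocʳ x m n) (trans (^-congʳ x (ℕ.*-comm m n)) (sym (^-assocʳ x n m)))

  -- Stated for all h ≥ - 1 because the continuity of powers at 1 applies it to a negative h. The
  -- induction step discards the nonnegative term n h².
  bernoulli : ∀ {h} n → 0# ≤ 1# + h → 1# + fromℕ n * h ≤ (1# + h) ^ n
  bernoulli {h} zero    0≤1+h = ≤-reflexive (solve 1 (λ h → :1 :+ con (+ 0) :* h := :1) refl h)
  bernoulli {h} (suc n) 0≤1+h = begin
    1# + (1# + fromℕ n) * h           ≤⟨ ≤-by (*-nonneg (fromℕ-nonneg n) (0≤h² h))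
      (solve 2 (λ h n → (:1 :+ h) :* (:1 :+ n :* h) :- (:1 :+ (:1 :+ n) :* h) := n :* (h :* h)) refl h (fromℕ n)) ⟩
    (1# + h) * (1# + fromℕ n * h)     ≤⟨ *-monoʳ-≤ 0≤1+h (bernoulli n 0≤1+h) ⟩
    (1# + h) * (1# + h) ^ n           ∎
    where
    0≤h² : ∀ h → 0# ≤ h * h
    0≤h² h with ≤-total 0# h
    ... | inj₁ 0≤h = *-nonneg 0≤h 0≤h
    ... | inj₂ h≤0 = ≤-trans (*-nonneg 0≤-h 0≤-h)
                       (inj₂ (solve 1 (λ h → :- h :* :- h := h :* h) refl h))
      where
      0≤-h : 0# ≤ - h
      0≤-h = ≤-trans (inj₂ (sym -0≈0)) (neg-antimono-≤ h≤0)

  ^-unbounded : ∀ {x} → 1# < x → ∀ K → ∃ λ n → K < x ^ n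
  ^-unbounded {x} 1<x K with archimedean (K / (x - 1#))
  ... | n , K/h<n = n , (begin-strict
    K                        ≈⟨ *⁻¹-cancelʳ 0<h ⟨
    K / (x - 1#) * (x - 1#)  <⟨ *-monoˡ-< 0<h K/h<n ⟩
    fromℕ n * (x - 1#)       ≤⟨ ≤-by 0≤1 (solve 1 (λ y → :1 :+ y :- y := :1) refl _) ⟩
    1# + fromℕ n * (x - 1#)  ≤⟨ bernoulli n (≤-trans (1≤⇒0≤ (<⇒≤ 1<x)) (inj₂ (sym 1+h≈x))) ⟩
    (1# + (x - 1#)) ^ n      ≈⟨ ^-congˡ n 1+h≈x ⟩
    x ^ n                    ∎)
    where
    0<h : 0# < x - 1#
    0<h = x<y⇒0<y-x 1<x
    1+h≈x : 1# + (x - 1#) ≈ x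
    1+h≈x = solve 1 (λ x → :1 :+ (x :- :1) := x) refl x

  -- Otherwise the powers of t / u would be bounded by K.
  ^-dominated⇒≤ : ∀ {t u K} → 0# < u → (∀ n → t ^ n ≤ K * u ^ n) → t ≤ u
  ^-dominated⇒≤ {t} {u} {K} 0<u tⁿ≤Kuⁿ = ≮⇒≥ λ u<t →
    let n , K<ρⁿ = ^-unbounded (<-/ 0<u (<-respˡ-≈ (sym (*-identityˡ u)) u<t)) K in
    <⇒≱ K<ρⁿ (*-cancelʳ-≤ (^-pos n 0<u) (begin
      (t / u) ^ n * u ^ n  ≈⟨ ^-distrib-* (t / u) u n ⟨
      (t / u * u) ^ n      ≈⟨ ^-congˡ n (*⁻¹-cancelʳ 0<u) ⟩
      t ^ n                ≤⟨ tⁿ≤Kuⁿ n ⟩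
      K * u ^ n            ∎))

  -- With h = (1 - τ⁻¹) / (1 + n), Bernoulli's inequality gives (1 - h)ⁿ ≥ τ⁻¹,
  -- and σ = (1 - h)⁻¹.
  ^-continuous-at-1 : ∀ n {τ} → 1# < τ → ∃ λ σ → 1# < σ × σ ^ n ≤ τ
  ^-continuous-at-1 n {τ} 1<τ = θ ⁻¹ , 1<σ , *-cancelʳ-≤ 0<ω (begin
    (θ ⁻¹) ^ n * ω          ≤⟨ *-monoʳ-≤ (^-nonneg n (<⇒≤ (⁻¹-pos 0<θ))) ω≤θⁿ ⟩
    (θ ⁻¹) ^ n * θ ^ n      ≈⟨ ^-distrib-* (θ ⁻¹) θ n ⟨
    (θ ⁻¹ * θ) ^ n          ≈⟨ ^-congˡ n (trans (*-comm _ _) (⁻¹-inverseʳ (0<⇒≉0 0<θ))) ⟩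
    1# ^ n                  ≈⟨ 1^ n ⟩
    1#                      ≈⟨ ⁻¹-inverseʳ (0<⇒≉0 0<τ) ⟨
    τ * ω                   ∎)
    where
    0<τ : 0# < τ
    0<τ = <-trans 0<1 1<τ
    ω h θ : Carrier
    ω = τ ⁻¹
    h = (1# - ω) / fromℕ (suc n)
    θ = 1# - h
    0<ω : 0# < ω
    0<ω = ⁻¹-pos 0<τ
    0<1-ω : 0# < 1# - ω
    0<1-ω = x<y⇒0<y-x (*-cancelˡ-< 0<τ (begin-strict
      τ * ω   ≈⟨ ⁻¹-inverseʳ (0<⇒≉0 0<τ) ⟩
      1#      <⟨ 1<τ ⟩
      τ       ≈⟨ *-identityʳ τ ⟨
      τ * 1#  ∎))
    0<h : 0# < h
    0<h = *-pos 0<1-ω (⁻¹-pos (fromℕ-pos n))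
    h[1+n] : h * fromℕ (suc n) ≈ 1# - ω
    h[1+n] = *⁻¹-cancelʳ (fromℕ-pos n)
    h≤1-ω : h ≤ 1# - ω
    h≤1-ω = begin
      h                    ≈⟨ *-identityʳ h ⟨
      h * 1#               ≤⟨ *-monoʳ-≤ (<⇒≤ 0<h) (1≤fromℕ {suc n} (ℕ.s≤s ℕ.z≤n)) ⟩
      h * fromℕ (suc n)    ≈⟨ h[1+n] ⟩
      1# - ω               ∎
    0<θ : 0# < θ
    0<θ = <-by (+-pos-nonneg 0<ω (x≤y⇒0≤y-x h≤1-ω))
      (solve 2 (λ h ω → :1 :- h :- con (+ 0) := ω :+ (:1 :- ω :- h)) refl h ω)
    1<σ : 1# < θ ⁻¹
    1<σ = *-cancelˡ-< 0<θ (begin-strict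
      θ * 1#    <⟨ <-by 0<h (solve 1 (λ h → :1 :- (:1 :- h) :* :1 := h) refl h) ⟩
      1#        ≈⟨ ⁻¹-inverseʳ (0<⇒≉0 0<θ) ⟨
      θ * θ ⁻¹  ∎)
    -- Dividing by 1 + n instead of n allows n = 0 and leaves a surplus: 1 - n h = ω + h.
    ω≤θⁿ : ω ≤ θ ^ n
    ω≤θⁿ = begin
      ω                     ≤⟨ ≤-by (<⇒≤ 0<h) (trans
        (solve 4 (λ h n ω g → :1 :+ n :* (:- h) :- ω := (:1 :- ω) :- h :* (:1 :+ n) :+ h) refl h (fromℕ n) ω h)
        (trans (+-congʳ (trans (+-congˡ (-‿cong h[1+n])) (-‿inverseʳ _))) (+-identityˡ h))) ⟩
      1# + fromℕ n * - h    ≤⟨ bernoulli n (<⇒≤ 0<θ) ⟩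
      θ ^ n                 ∎

  -- The restriction to z ≥ 1 keeps products and powers monotone; it loses nothing, as roots are
  -- taken only of numbers at least 1.
  IsRootLowerBound : ℕ → Carrier → Pred Carrier 0ℓ
  IsRootLowerBound n x z = 1# ≤ z × z ^ n ≤ x

  -- If sⁿ⁺¹ < x, continuity of powers at 1 gives σ > 1 for which s σ is still a member of the set.
  -- If sⁿ⁺¹ > x, it gives σ > 1 for which s / σ is still an upper bound.
  sup-root : ∀ n {x s} → 1# ≤ x → IsSupremum (IsRootLowerBound (suc n) x) s → 1# ≤ s → s ^ suc n ≈ x
  sup-root n {x} {s} 1≤x (s-bound , s-least) 1≤s = ≤-antisym (≮⇒≥ sⁿ≯x) (≮⇒≥ sⁿ≮x)
    where
    0<x : 0# < x
    0<x = 1≤⇒0< 1≤x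

    0<s : 0# < s
    0<s = 1≤⇒0< 1≤s

    0<sⁿ : 0# < s ^ suc n
    0<sⁿ = ^-pos (suc n) 0<s

    s<s* : ∀ {σ} → 1# < σ → s < s * σ
    s<s* 1<σ = <-respˡ-≈ (*-identityʳ s) (*-monoʳ-< 0<s 1<σ)

    sⁿ≮x : ¬ s ^ suc n < x
    sⁿ≮x sⁿ<x = <⇒≱ (s<s* 1<σ) (s-bound (s * σ) (1≤* 1≤s (<⇒≤ 1<σ) , (begin
        (s * σ) ^ suc n                  ≈⟨ ^-distrib-* s σ (suc n) ⟩
        s ^ suc n * σ ^ suc n            ≤⟨ *-monoʳ-≤ (<⇒≤ 0<sⁿ) σⁿ≤τ ⟩
        s ^ suc n * (x / s ^ suc n)      ≈⟨ *-comm _ _ ⟩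
        x / s ^ suc n * s ^ suc n        ≈⟨ *⁻¹-cancelʳ 0<sⁿ ⟩
        x                                ∎)))
      where
      factor : ∃ λ σ → 1# < σ × σ ^ suc n ≤ x / s ^ suc n
      factor = ^-continuous-at-1 (suc n) (<-/ 0<sⁿ (<-respˡ-≈ (sym (*-identityˡ (s ^ suc n))) sⁿ<x))
      σ : Carrier
      σ = proj₁ factor
      1<σ : 1# < σ
      1<σ = proj₁ (proj₂ factor)
      σⁿ≤τ : σ ^ suc n ≤ x / s ^ suc n
      σⁿ≤τ = proj₂ (proj₂ factor)

    sⁿ≯x : ¬ x < s ^ suc n
    sⁿ≯x x<sⁿ = <⇒≱ (s<s* 1<σ) (≤-trans (*-monoˡ-≤ (<⇒≤ 0<σ) s≤s/σ) (≤-reflexive (*⁻¹-cancelʳ 0<σ)))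
      where
      factor : ∃ λ σ → 1# < σ × σ ^ suc n ≤ s ^ suc n / x
      factor = ^-continuous-at-1 (suc n) (<-/ 0<x (<-respˡ-≈ (sym (*-identityˡ x)) x<sⁿ))
      σ : Carrier
      σ = proj₁ factor
      1<σ : 1# < σ
      1<σ = proj₁ (proj₂ factor)
      0<σ : 0# < σ
      0<σ = <-trans 0<1 1<σ
      σⁿ≤τ : σ ^ suc n ≤ s ^ suc n / x
      σⁿ≤τ = proj₂ (proj₂ factor)
      s≤s/σ : s ≤ s / σ
      s≤s/σ = s-least (s / σ) λ z (1≤z , zⁿ≤x) →
        ≤-/ 0<σ (^-cancel-≤ n (<⇒≤ 0<s) (begin
          (z * σ) ^ suc n          ≈⟨ ^-distrib-* z σ (suc n) ⟩
          z ^ suc n * σ ^ suc n    ≤⟨ *-mono-≤ (^-nonneg (suc n) (1≤⇒0≤ 1≤z))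
                                        (^-nonneg (suc n) (<⇒≤ 0<σ)) zⁿ≤x σⁿ≤τ ⟩
          x * (s ^ suc n / x)      ≈⟨ *-comm x (s ^ suc n / x) ⟩
          s ^ suc n / x * x        ≈⟨ *⁻¹-cancelʳ 0<x ⟩
          s ^ suc n                ∎))

  ^-root : ∀ n {x} → 1# ≤ x → ∃ λ y → 1# ≤ y × y ^ suc n ≈ x
  ^-root n {x} 1≤x = proj₁ supremum , 1≤s , sup-root n 1≤x (proj₂ supremum) 1≤s
    where
    bounded : UpperBound (IsRootLowerBound (suc n) x) x
    bounded z (1≤z , zⁿ≤x) = begin
      z            ≈⟨ *-identityʳ z ⟨
      z * 1#       ≤⟨ *-monoʳ-≤ (1≤⇒0≤ 1≤z) (1≤^ n 1≤z) ⟩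
      z * z ^ n    ≤⟨ zⁿ≤x ⟩
      x            ∎

    1-bound : IsRootLowerBound (suc n) x 1#
    1-bound = ≤-refl , ≤-trans (≤-reflexive (1^ (suc n))) 1≤x

    supremum : ∃ (IsSupremum (IsRootLowerBound (suc n) x))
    supremum = complete (IsRootLowerBound (suc n) x) (1# , 1-bound) (x , bounded)

    1≤s : 1# ≤ proj₁ supremum
    1≤s = proj₁ (proj₂ supremum) 1# 1-bound

  sup-isSupremum : ∀ {P} → ∃ P → ∃ (UpperBound P) → IsSupremum P (sup P)
  sup-isSupremum {P} inhabited bounded with em {∃ P × ∃ (UpperBound P)}
  ... | yes (i , b) = proj₂ (complete P i b)
  ... | no ¬both    = contradiction (inhabited , bounded) ¬both

  -- Rationals are stored in lowest terms. Keeping the cancelled factor `suc g` lets statements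
  -- about i and n be transferred to the numerator and denominator of q.
  ℚ-reduce : ∀ i n → 0 ℕ.< n → ∃ λ q → ∃ λ g → ↥ q ℤ.* + suc g ≡ i × ↧ₙ q ℕ.* suc g ≡ n
  ℚ-reduce i n@(suc _) 0<n =
    q , positive (ℕ.gcd ℤ.∣ i ∣ n) (ℚ.↥-/ i n) (ℤ.+-injective (≡.trans (ℤ.pos-* (↧ₙ q) _) (ℚ.↧-/ i n)))
    where
    q : ℚ
    q = i ℚ./ n
    positive : ∀ g → ↥ q ℤ.* + g ≡ i → ↧ₙ q ℕ.* g ≡ n → ∃ λ g → ↥ q ℤ.* + suc g ≡ i × ↧ₙ q ℕ.* suc g ≡ n
    -- A vanishing greatest common divisor would force n = 0.
    positive zero    _  q0≡n = contradiction (≡.trans (≡.sym q0≡n) (ℕ.*-zeroʳ (↧ₙ q))) λ ()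
    positive (suc g) ig≡ ng≡ = g , ig≡ , ng≡

  -- Real powers of bases at least 1

  -- For x, t ≥ 1 this characterises t = xᵃ: the comparisons of log t / log x
  -- with rationals agree with those of a.
  record IsPow (x a t : Carrier) : Set where
    field
      lower : ∀ m n → fromℕ m ≤ fromℕ n * a → x ^ m ≤ t ^ n
      upper : ∀ m n → fromℕ n * a ≤ fromℕ m → t ^ n ≤ x ^ m

  open IsPow

  isPow-1≤ : ∀ {x a t} → 0# ≤ a → IsPow x a t → 1# ≤ t
  isPow-1≤ {t = t} 0≤a p = ≤-trans (lower p 0 1 (*-nonneg (fromℕ-nonneg 1) 0≤a)) (≤-reflexive (*-identityʳ t))

  isPow-zero : ∀ {x} → 1# ≤ x → IsPow x 0# 1#
  isPow-zero 1≤x .lower m n m≤n0 with fromℕ-cancel-≤ {m} {0} (≤-trans m≤n0 (≤-reflexive (zeroʳ _)))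
  ... | ℕ.z≤n = ≤-reflexive (sym (1^ n))
  isPow-zero 1≤x .upper m n _ = ≤-trans (≤-reflexive (1^ n)) (1≤^ m 1≤x)

  isPow-* : ∀ {x y a t u} → 1# ≤ x → 1# ≤ y → 1# ≤ t → 1# ≤ u →
    IsPow x a t → IsPow y a u → IsPow (x * y) a (t * u)
  isPow-* {x} {y} {a} {t} {u} 1≤x 1≤y 1≤t 1≤u p q .lower m n h = begin
    (x * y) ^ m    ≈⟨ ^-distrib-* x y m ⟩
    x ^ m * y ^ m  ≤⟨ *-mono-≤ (^-nonneg m (1≤⇒0≤ 1≤x)) (^-nonneg m (1≤⇒0≤ 1≤y)) (lower p m n h) (lower q m n h) ⟩
    t ^ n * u ^ n  ≈⟨ ^-distrib-* t u n ⟨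
    (t * u) ^ n    ∎
  isPow-* {x} {y} {a} {t} {u} 1≤x 1≤y 1≤t 1≤u p q .upper m n h = begin
    (t * u) ^ n    ≈⟨ ^-distrib-* t u n ⟩
    t ^ n * u ^ n  ≤⟨ *-mono-≤ (^-nonneg n (1≤⇒0≤ 1≤t)) (^-nonneg n (1≤⇒0≤ 1≤u)) (upper p m n h) (upper q m n h) ⟩
    x ^ m * y ^ m  ≈⟨ ^-distrib-* x y m ⟨
    (x * y) ^ m    ∎

  isPow-inverse : ∀ {x a t} → 0# < a → IsPow x (a ⁻¹) t → IsPow t a x
  isPow-inverse {x} {a} {t} 0<a p .lower m n m≤na = upper p n m (/-≤ 0<a m≤na)
  isPow-inverse {x} {a} {t} 0<a p .upper m n na≤m = lower p n m (≤-/ 0<a na≤m)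

  -- Taking m = ⌊n a⌋ loses only one factor x between tⁿ and uⁿ. This factor does not depend on n,
  -- so `^-dominated⇒≤` removes it. With x = y this also gives uniqueness of the power.
  isPow-mono : ∀ {x y a t u} → 0# ≤ a → 1# ≤ x → x ≤ y → IsPow x a t → IsPow y a u → t ≤ u
  isPow-mono {x} {y} {a} {t} {u} 0≤a 1≤x x≤y p q = ^-dominated⇒≤ (1≤⇒0< (isPow-1≤ 0≤a q)) λ n →
    let m , m≤na , na<1+m = floorℕ (*-nonneg (fromℕ-nonneg n) 0≤a) in begin
    t ^ n      ≤⟨ upper p (suc m) n (<⇒≤ na<1+m) ⟩
    x * x ^ m  ≤⟨ *-monoʳ-≤ (1≤⇒0≤ 1≤x) (^-mono-≤ m (1≤⇒0≤ 1≤x) x≤y) ⟩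
    x * y ^ m  ≤⟨ *-monoʳ-≤ (1≤⇒0≤ 1≤x) (lower q m n m≤na) ⟩
    x * u ^ n  ∎

  -- For bases at least 1 the exponent a may be replaced by a natural m > a, which reduces the claim
  -- to natural powers.
  isPow-continuous-at-1 : ∀ {a τ} → 1# < τ → ∃ λ σ → 1# < σ ×
    (∀ {x t} → 1# ≤ x → x ≤ σ → IsPow x a t → t ≤ τ)
  isPow-continuous-at-1 {a} {τ} 1<τ =
    let m , a<m        = archimedean a
        σ , 1<σ , σᵐ≤τ = ^-continuous-at-1 m 1<τ
    in σ , 1<σ , λ {x} {t} 1≤x x≤σ p → begin
      t      ≈⟨ *-identityʳ t ⟨
      t ^ 1  ≤⟨ upper p m 1 (≤-trans (≤-reflexive (solve 1 (λ a → (:1 :+ con (+ 0)) :* a := a) refl a)) (<⇒≤ a<m)) ⟩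
      x ^ m  ≤⟨ ^-mono-≤ m (1≤⇒0≤ 1≤x) x≤σ ⟩
      σ ^ m  ≤⟨ σᵐ≤τ ⟩
      τ      ∎

  -- Choose n with n (b - a) ≥ 2, so that tⁿ ≤ xᵐ⁺¹ and xᵐ⁺² ≤ uⁿ for m = ⌊n a⌋.
  isPow-growth : ∀ {a b} → 0# ≤ a → a < b → ∀ M → ∃ λ X → 1# ≤ X ×
    (∀ {x t u} → X ≤ x → IsPow x a t → IsPow x b u → M * t ≤ u)
  isPow-growth {a} {b} 0≤a a<b M with maximum M 1# | archimedean (2# / (b - a))
  ... | K , M≤K , 1≤K | zero , 2/d<0 = contradiction (<⇒≤ (*-pos 0<2 (⁻¹-pos (x<y⇒0<y-x a<b)))) (<⇒≱ 2/d<0)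
  -- The threshold Kⁿ comes from comparing n-th powers: the spare factor x between xᵐ⁺¹ and xᵐ⁺² has
  -- to absorb Kⁿ.
  ... | K , M≤K , 1≤K | n@(suc n-1) , 2/d<n = K ^ n , 1≤^ n 1≤K , λ {x} {t} {u} Kⁿ≤x p q →
    let 1≤x : 1# ≤ x
        1≤x = ≤-trans (1≤^ n 1≤K) Kⁿ≤x
        1≤t : 1# ≤ t
        1≤t = isPow-1≤ 0≤a p
        1≤u : 1# ≤ u
        1≤u = isPow-1≤ (≤-trans 0≤a (<⇒≤ a<b)) q
        m , m≤na , na<1+m = floorℕ (*-nonneg (fromℕ-nonneg n) 0≤a)
    in begin
    M * t  ≤⟨ *-monoˡ-≤ (1≤⇒0≤ 1≤t) M≤K ⟩
    K * t  ≤⟨ ^-cancel-≤ n-1 (1≤⇒0≤ 1≤u) (begin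
      (K * t) ^ n        ≈⟨ ^-distrib-* K t n ⟩
      K ^ n * t ^ n      ≤⟨ *-mono-≤ (^-nonneg n (1≤⇒0≤ 1≤K)) (^-nonneg n (1≤⇒0≤ 1≤t)) Kⁿ≤x
                              (upper p (suc m) n (<⇒≤ na<1+m)) ⟩
      x ^ (2 ℕ.+ m)      ≤⟨ lower q (2 ℕ.+ m) n (2+m≤nb m m≤na) ⟩
      u ^ n              ∎) ⟩
    u      ∎
    where
    0<d : 0# < b - a
    0<d = x<y⇒0<y-x a<b
    2+m≤nb : ∀ m → fromℕ m ≤ fromℕ n * a → fromℕ (2 ℕ.+ m) ≤ fromℕ n * b
    2+m≤nb m m≤na = ≤-by (+-nonneg (x≤y⇒0≤y-x m≤na) (x≤y⇒0≤y-x 2≤nd))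
      (solve 4 (λ n a b m → n :* b :- (:1 :+ (:1 :+ m)) := n :* a :- m :+ (n :* (b :- a) :- :2)) refl
        (fromℕ n) a b (fromℕ m))
      where
      2≤nd : 2# ≤ fromℕ n * (b - a)
      2≤nd = begin
        2#                        ≈⟨ *⁻¹-cancelʳ 0<d ⟨
        2# / (b - a) * (b - a)    ≤⟨ *-monoˡ-≤ (<⇒≤ 0<d) (<⇒≤ 2/d<n) ⟩
        fromℕ n * (b - a)         ∎

  -- The set whose supremum defines `pow≥1 x a`.
  RationalPowerBelow : Carrier → Carrier → Pred Carrier 0ℓ
  RationalPowerBelow x a y = ∃ λ q → fromℚ q ≤ a × IsRationalPower x q y

  -- For an exponent k / d ≥ 0, the inequalities k ≤ a d and n a ≤ m give k n ≤ m d, and the claim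
  -- follows by comparing d-th powers. A negative exponent makes y at most 1.
  rationalPower-≤ : ∀ {x a y} → 1# ≤ x → RationalPowerBelow x a y →
    ∀ m n → fromℕ n * a ≤ fromℕ m → y ^ n ≤ x ^ m
  rationalPower-≤ {x} {a} {y} 1≤x (mkℚ (+ k) d-1 _ , k/d≤a , 0<y , yᵈ≈xᵏ) m n na≤m =
    ^-cancel-≤ d-1 (^-nonneg m (1≤⇒0≤ 1≤x)) (begin
      (y ^ n) ^ d    ≈⟨ ^-swap y n d ⟩
      (y ^ d) ^ n    ≈⟨ ^-congˡ n yᵈ≈xᵏ ⟩
      (x ^ k) ^ n    ≈⟨ ^-assocʳ x k n ⟩
      x ^ (k ℕ.* n)  ≤⟨ ^-monoʳ-≤ 1≤x kn≤md ⟩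
      x ^ (m ℕ.* d)  ≈⟨ ^-assocʳ x m d ⟨
      (x ^ m) ^ d    ∎)
    where
    d : ℕ
    d = suc d-1
    0<d : 0# < fromℕ d
    0<d = fromℕ-pos d-1
    kn≤md : k ℕ.* n ℕ.≤ m ℕ.* d
    kn≤md = fromℕ-cancel-≤ (begin
      fromℕ (k ℕ.* n)                      ≈⟨ fromℕ-homo-* k n ⟩
      fromℕ k * fromℕ n                    ≈⟨ *-congʳ (*⁻¹-cancelʳ 0<d) ⟨
      fromℕ k / fromℕ d * fromℕ d * fromℕ n  ≤⟨ *-monoˡ-≤ (fromℕ-nonneg n) (*-monoˡ-≤ (<⇒≤ 0<d) k/d≤a) ⟩
      a * fromℕ d * fromℕ n                ≈⟨ solve 3 (λ a d n → a :* d :* n := n :* a :* d) refl a (fromℕ d) (fromℕ n) ⟩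
      fromℕ n * a * fromℕ d                ≤⟨ *-monoˡ-≤ (<⇒≤ 0<d) na≤m ⟩
      fromℕ m * fromℕ d                    ≈⟨ fromℕ-homo-* m d ⟨
      fromℕ (m ℕ.* d)                      ∎)
  rationalPower-≤ {x} {a} {y} 1≤x (mkℚ -[1+ k ] d-1 _ , _ , 0<y , yᵈ≈x⁻ᵏ) m n _ = begin
    y ^ n   ≤⟨ ^-mono-≤ n (<⇒≤ 0<y) y≤1 ⟩
    1# ^ n  ≈⟨ 1^ n ⟩
    1#      ≤⟨ 1≤^ m 1≤x ⟩
    x ^ m   ∎
    where
    y≤1 : y ≤ 1#
    y≤1 = ^-cancel-≤ d-1 0≤1 (begin
      y ^ suc d-1            ≈⟨ yᵈ≈x⁻ᵏ ⟩
      (x ^ suc k) ⁻¹         ≤⟨ *-cancelˡ-≤ (^-pos (suc k) (1≤⇒0< 1≤x)) (begin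
        x ^ suc k * (x ^ suc k) ⁻¹  ≈⟨ ⁻¹-inverseʳ (0<⇒≉0 (^-pos (suc k) (1≤⇒0< 1≤x))) ⟩
        1#                          ≤⟨ 1≤^ (suc k) 1≤x ⟩
        x ^ suc k                   ≈⟨ *-identityʳ _ ⟨
        x ^ suc k * 1#              ∎) ⟩
      1#                     ≈⟨ 1^ (suc d-1) ⟨
      1# ^ suc d-1           ∎)

  -- If m / n is k / d in lowest terms, the d-th root of xᵏ serves, its n-th power being a power of
  -- its d-th. One clause of `reduced` is enough, as a negative numerator contradicts the equation
  -- with `+ m`.
  rationalPower-exists : ∀ {x a} → 1# ≤ x → ∀ m n → 0 ℕ.< n → fromℕ m ≤ fromℕ n * a →
    ∃ λ y → RationalPowerBelow x a y × y ^ n ≈ x ^ m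
  rationalPower-exists {x} {a} 1≤x m n 0<n m≤na =
    let q , g-1 , kg≡m , dg≡n = ℚ-reduce (+ m) n 0<n in reduced q g-1 kg≡m dg≡n
    where
    reduced : ∀ q g-1 → ↥ q ℤ.* + suc g-1 ≡ + m → ↧ₙ q ℕ.* suc g-1 ≡ n →
      ∃ λ y → RationalPowerBelow x a y × y ^ n ≈ x ^ m
    reduced q@(mkℚ (+ k) d-1 _) g-1 kg≡m dg≡n = root (^-root d-1 (1≤^ k 1≤x))
      where
      d g : ℕ
      d = suc d-1
      g = suc g-1
      kg≡m′ : k ℕ.* g ≡ m
      kg≡m′ = ℤ.+-injective (≡.trans (ℤ.pos-* k g) kg≡m)
      k/d≤a : fromℕ k / fromℕ d ≤ a
      k/d≤a = /-≤ (fromℕ-pos d-1) (*-cancelʳ-≤ (fromℕ-pos g-1) (begin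
        fromℕ k * fromℕ g      ≈⟨ fromℕ-homo-* k g ⟨
        fromℕ (k ℕ.* g)        ≡⟨ ≡.cong fromℕ kg≡m′ ⟩
        fromℕ m                ≤⟨ m≤na ⟩
        fromℕ n * a            ≡⟨ ≡.cong (λ n → fromℕ n * a) dg≡n ⟨
        fromℕ (d ℕ.* g) * a    ≈⟨ *-congʳ (fromℕ-homo-* d g) ⟩
        fromℕ d * fromℕ g * a  ≈⟨ solve 3 (λ d g a → d :* g :* a := a :* d :* g) refl (fromℕ d) (fromℕ g) a ⟩
        a * fromℕ d * fromℕ g  ∎))
      root : (∃ λ y → 1# ≤ y × y ^ d ≈ x ^ k) → ∃ λ y → RationalPowerBelow x a y × y ^ n ≈ x ^ m
      root (y , 1≤y , yᵈ≈xᵏ) = y , (q , k/d≤a , 1≤⇒0< 1≤y , yᵈ≈xᵏ) , (begin-equality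
        y ^ n          ≡⟨ ≡.cong (y ^_) dg≡n ⟨
        y ^ (d ℕ.* g)  ≈⟨ ^-assocʳ y d g ⟨
        (y ^ d) ^ g    ≈⟨ ^-congˡ g yᵈ≈xᵏ ⟩
        (x ^ k) ^ g    ≈⟨ ^-assocʳ x k g ⟩
        x ^ (k ℕ.* g)  ≡⟨ ≡.cong (x ^_) kg≡m′ ⟩
        x ^ m          ∎)

  -- A lower comparison m ≤ n a puts the power with exponent m / n into the set. For an upper
  -- comparison n a ≤ m the n-th root of xᵐ is an upper bound of the set. The case n = 0 is
  -- separate, since m / n is then no exponent.
  sup-isPow : ∀ {x a s} → 1# ≤ x → 0# ≤ a → IsSupremum (RationalPowerBelow x a) s → IsPow x a s
  sup-isPow {x} {a} {s} 1≤x 0≤a (s-bound , s-least) = record { lower = lower-s ; upper = upper-s }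
    where
    below-s : ∀ {y} n {z} → RationalPowerBelow x a y → y ^ n ≈ z → z ≤ s ^ n
    below-s {y} n r@(_ , _ , 0<y , _) yⁿ≈z =
      ≤-trans (≤-reflexive (sym yⁿ≈z)) (^-mono-≤ n (<⇒≤ 0<y) (s-bound y r))

    lower-s : ∀ m n → fromℕ m ≤ fromℕ n * a → x ^ m ≤ s ^ n
    lower-s zero    zero    _    = ≤-refl
    lower-s (suc m) zero    m≤0a =
      contradiction (≤-trans m≤0a (≤-reflexive (zeroˡ a))) (<⇒≱ (fromℕ-pos m))
    lower-s m       (suc n) m≤na =
      let y , r , yⁿ≈xᵐ = rationalPower-exists 1≤x m (suc n) (ℕ.s≤s ℕ.z≤n) m≤na
      in below-s (suc n) r yⁿ≈xᵐ

    1≤s : 1# ≤ s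
    1≤s = ≤-trans (lower-s 0 1 (*-nonneg (fromℕ-nonneg 1) 0≤a)) (≤-reflexive (*-identityʳ s))

    below-root : ∀ m n → fromℕ (suc n) * a ≤ fromℕ m → (∃ λ z → 1# ≤ z × z ^ suc n ≈ x ^ m) →
      s ^ suc n ≤ x ^ m
    below-root m n na≤m (z , 1≤z , zⁿ≈xᵐ) =
      ≤-trans (^-mono-≤ (suc n) (1≤⇒0≤ 1≤s) s≤z) (≤-reflexive zⁿ≈xᵐ)
      where
      s≤z : s ≤ z
      s≤z = s-least z λ y r → ^-cancel-≤ n (1≤⇒0≤ 1≤z)
        (≤-trans (rationalPower-≤ 1≤x r m (suc n) na≤m) (≤-reflexive (sym zⁿ≈xᵐ)))

    upper-s : ∀ m n → fromℕ n * a ≤ fromℕ m → s ^ n ≤ x ^ m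
    upper-s m zero    _    = 1≤^ m 1≤x
    upper-s m (suc n) na≤m = below-root m n na≤m (^-root n (1≤^ m 1≤x))

  -- The default value of `sup` does not occur: exponent 0 provides a member of the set, and xᴺ with
  -- a natural N > a bounds it.
  pow≥1-isPow : ∀ {x a} → 1# ≤ x → 0# ≤ a → IsPow x a (pow≥1 x a)
  pow≥1-isPow {x} {a} 1≤x 0≤a = sup-isPow 1≤x 0≤a (sup-isSupremum
    (nonempty (rationalPower-exists 1≤x 0 1 (ℕ.s≤s ℕ.z≤n) (*-nonneg (fromℕ-nonneg 1) 0≤a)))
    (bounded (archimedean a)))
    where
    nonempty : (∃ λ y → RationalPowerBelow x a y × y ^ 1 ≈ x ^ 0) → ∃ (RationalPowerBelow x a)
    nonempty (y , r , _) = y , r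

    bounded : (∃ λ N → a < fromℕ N) → ∃ (UpperBound (RationalPowerBelow x a))
    bounded (N , a<N) = x ^ N , λ y r → ≤-trans (≤-reflexive (sym (*-identityʳ y)))
      (rationalPower-≤ 1≤x r N 1 (≤-trans
        (≤-reflexive (solve 1 (λ a → (:1 :+ con (+ 0)) :* a := a) refl a)) (<⇒≤ a<N)))

  ^ʳ-isPow : ∀ {x a} → 1# ≤ x → 0# ≤ a → IsPow x a (x ^ʳ a)
  ^ʳ-isPow {x} {a} 1≤x 0≤a with 0# <? x | x <? 1#
  ... | no 0≮x | _       = contradiction (1≤⇒0< 1≤x) 0≮x
  ... | yes _  | yes x<1 = contradiction 1≤x (<⇒≱ x<1)
  ... | yes _  | no  _   = pow≥1-isPow 1≤x 0≤a

  ^ʳ-isPow-⁻¹ : ∀ {x a} → 0# < x → x < 1# → 0# ≤ a → ∃ λ t → IsPow (x ⁻¹) a t × x ^ʳ a ≈ t ⁻¹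
  ^ʳ-isPow-⁻¹ {x} {a} 0<x x<1 0≤a with 0# <? x | x <? 1#
  ... | no 0≮x | _      = contradiction 0<x 0≮x
  ... | yes _  | no x≮1 = contradiction x<1 x≮1
  ... | yes _  | yes _  = pow≥1 (x ⁻¹) a , pow≥1-isPow (1≤⁻¹ 0<x (<⇒≤ x<1)) 0≤a , refl

  -- Diophantine approximation

  open ℤSolver.+-*-Solver using () renaming
    (solve to solveℤ; _:+_ to _:+ℤ_; _:*_ to _:*ℤ_; _:-_ to _:-ℤ_; :-_ to :-ℤ_; _:=_ to _:=ℤ_)

  irrational⇒qα≉p : ∀ {α} → Irrational α → ∀ q p → 0 ℕ.< q → fromℕ q * α ≉ fromℤ p
  irrational⇒qα≉p {α} irrational q p 0<q qα≈p =
    let r , g , ng≡p , dg≡q = ℚ-reduce p q 0<q in irrational r (α≈r r g ng≡p dg≡q)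
    where
    α≈r : ∀ r g → ↥ r ℤ.* + suc g ≡ p → ↧ₙ r ℕ.* suc g ≡ q → α ≈ fromℚ r
    α≈r (mkℚ i d-1 _) g ig≡p dg≡q = begin-equality
      α                    ≈⟨ *⁻¹-cancelʳ 0<d ⟨
      α / d * d            ≈⟨ solve 3 (λ α d d⁻¹ → α :* d⁻¹ :* d := α :* d :* d⁻¹) refl α d (d ⁻¹) ⟩
      α * d / d            ≈⟨ *-congʳ αd≈i ⟩
      fromℤ i / d          ∎
      where
      d G : Carrier
      d = fromℕ (suc d-1)
      G = fromℕ (suc g)
      0<d : 0# < d
      0<d = fromℕ-pos d-1
      0<G : 0# < G
      0<G = fromℕ-pos g
      dGα≈iG : d * G * α ≈ fromℤ i * G
      dGα≈iG = begin-equality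
        d * G * α                     ≈⟨ *-congʳ (fromℕ-homo-* (suc d-1) (suc g)) ⟨
        fromℕ (suc d-1 ℕ.* suc g) * α ≡⟨ ≡.cong (λ n → fromℕ n * α) dg≡q ⟩
        fromℕ q * α                   ≈⟨ qα≈p ⟩
        fromℤ p                       ≡⟨ ≡.cong fromℤ ig≡p ⟨
        fromℤ (i ℤ.* + suc g)         ≈⟨ fromℤ-homo-* i (+ suc g) ⟩
        fromℤ i * G                   ∎
      αd≈i : α * d ≈ fromℤ i
      αd≈i = begin-equality
        α * d               ≈⟨ *⁻¹-cancelʳ 0<G ⟨
        α * d / G * G       ≈⟨ solve 4 (λ α d G⁻¹ G → α :* d :* G⁻¹ :* G := d :* G :* α :* G⁻¹) refl α d (G ⁻¹) G ⟩
        d * G * α / G       ≈⟨ *-congʳ dGα≈iG ⟩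
        fromℤ i * G / G     ≈⟨ solve 3 (λ i G G⁻¹ → i :* G :* G⁻¹ := i :* G⁻¹ :* G) refl (fromℤ i) G (G ⁻¹) ⟩
        fromℤ i / G * G     ≈⟨ *⁻¹-cancelʳ 0<G ⟩
        fromℤ i             ∎

  -- Consecutive convergents a/b and c/d of α; the sign e = ±1 makes the errors
  -- e (b α - a) > e (c - d α) positive.
  record Convergents (α : Carrier) (k : ℕ) : Set where
    constructor convergents
    field
      b d   : ℕ
      a c e : ℤ
      e²≡1  : e ℤ.* e ≡ + 1
      det   : e ℤ.* (+ b ℤ.* c ℤ.- a ℤ.* + d) ≡ + 1
      0<d   : 0 ℕ.< d
      b≤d   : b ℕ.≤ d
      -- Progress is measured by b + d, which grows by at least 1 at each step, whereas d may stay
      -- at 1 in the first one.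
      k≤b+d : k ℕ.≤ b ℕ.+ d
      0<err : 0# < fromℤ e * (fromℤ c - fromℕ d * α)
      err<  : fromℤ e * (fromℤ c - fromℕ d * α) < fromℤ e * (fromℕ b * α - fromℤ a)

  module _ {α : Carrier} (irrational : Irrational α) where

    -- The formal fraction 1 / 0, with error 1, precedes ⌊α⌋ / 1, whose error α - ⌊α⌋ is nonzero by
    -- irrationality. As ⌊α⌋ lies below α, the sign is - 1.
    firstConvergents : Convergents α 1
    firstConvergents = initial (floor α)
      where
      initial : (∃ λ i → fromℤ i ≤ α × α < 1# + fromℤ i) → Convergents α 1
      initial (i , i≤α , α<1+i) = convergents 0 1 (+ 1) i -[1+ 0 ] ≡.refl ≡.refl (ℕ.s≤s ℕ.z≤n) ℕ.z≤n (ℕ.s≤s ℕ.z≤n)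
        (<-respʳ-≈ (sym err≈) (x<y⇒0<y-x i<α))
        (<-by (x<y⇒0<y-x α<1+i) (trans (+-congˡ (-‿cong err≈))
          (solve 2 (λ i α → (:- (:1 :+ con (+ 0))) :* (con (+ 0) :* α :- (:1 :+ con (+ 0))) :- (α :- i)
                     := :1 :+ i :- α) refl (fromℤ i) α)))
        where
        err≈ : - (1# + 0#) * (fromℤ i - (1# + 0#) * α) ≈ α - fromℤ i
        err≈ = solve 2 (λ i α → (:- (:1 :+ con (+ 0))) :* (i :- (:1 :+ con (+ 0)) :* α) := α :- i) refl (fromℤ i) α
        i<α : fromℤ i < α
        i<α = [ (λ i<α → i<α) , (λ i≈α → contradiction
          (trans (solve 1 (λ α → (:1 :+ con (+ 0)) :* α := α) refl α) (sym i≈α))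
          (irrational⇒qα≉p irrational 1 i (ℕ.s≤s ℕ.z≤n))) ]′ i≤α

    -- A step of the Euclidean algorithm on the errors u > v: the partial quotient n = ⌊u / v⌋
    -- leaves the new error u - n v < v, which irrationality keeps positive. The sign changes at
    -- each step.
    nextConvergents : ∀ {k} → Convergents α k → Convergents α (suc k)
    nextConvergents {k} (convergents b d a c e e²≡1 det 0<d b≤d k≤b+d 0<err err<) = quotient (floorℕ {u / v} (<⇒≤ 0<u/v))
      where
      E A B C D u v : Carrier
      E = fromℤ e
      A = fromℤ a
      B = fromℕ b
      C = fromℤ c
      D = fromℕ d
      u = E * (B * α - A)
      v = E * (C - D * α)
      0<u/v : 0# < u / v
      0<u/v = *-pos (<-trans 0<err err<) (⁻¹-pos 0<err)
      quotient : (∃ λ n → fromℕ n ≤ u / v × u / v < fromℕ (suc n)) → Convergents α (suc k)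
      quotient (n , n≤u/v , u/v<1+n) = convergents d d′ c c′ (ℤ.- e)
        (≡.trans (solveℤ 1 (λ e → (:-ℤ e) :*ℤ (:-ℤ e) :=ℤ e :*ℤ e) ≡.refl e) e²≡1)
        (≡.trans (≡.trans (≡.cong (λ D → ℤ.- e ℤ.* (+ d ℤ.* c′ ℤ.- c ℤ.* D)) +d′≡)
          (solveℤ 6 (λ e a b c d n → (:-ℤ e) :*ℤ (d :*ℤ (a :+ℤ n :*ℤ c) :-ℤ c :*ℤ (b :+ℤ n :*ℤ d))
                       :=ℤ e :*ℤ (b :*ℤ c :-ℤ a :*ℤ d)) ≡.refl e a (+ b) c (+ d) (+ n))) det)
        (ℕ.<-≤-trans 0<d d≤d′)
        d≤d′
        (ℕ.+-mono-≤ 0<d (ℕ.≤-trans k≤b+d b+d≤d′))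
        (<-respʳ-≈ (sym v′≈) 0<u-nv)
        (<-by (x<y⇒0<y-x u-nv<v) (trans (+-cong u′≈ (-‿cong v′≈)) refl))
        where
        N : Carrier
        N = fromℕ n
        d′ : ℕ
        d′ = b ℕ.+ n ℕ.* d
        c′ : ℤ
        c′ = a ℤ.+ + n ℤ.* c
        +d′≡ : + d′ ≡ + b ℤ.+ + n ℤ.* + d
        +d′≡ = ≡.cong (λ i → + b ℤ.+ i) (ℤ.pos-* n d)
        D′≈ : fromℕ d′ ≈ B + N * D
        D′≈ = trans (fromℕ-homo-+ b (n ℕ.* d)) (+-congˡ (fromℕ-homo-* n d))
        C′≈ : fromℤ c′ ≈ A + N * C
        C′≈ = trans (fromℤ-homo-+ a (+ n ℤ.* c)) (+-congˡ (fromℤ-homo-* (+ n) c))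
        -- The ordering v < u of the errors makes the partial quotient at least 1, hence d′ ≥ b + d.
        1<1+n : 1 ℕ.< suc n
        1<1+n = fromℕ-cancel-< (begin-strict
          1# + 0#          ≈⟨ +-identityʳ 1# ⟩
          1#               <⟨ <-/ 0<err (<-respˡ-≈ (sym (*-identityˡ v)) err<) ⟩
          u / v            <⟨ u/v<1+n ⟩
          fromℕ (suc n)    ∎)
        d≤nd : d ℕ.≤ n ℕ.* d
        d≤nd = ℕ.≤-trans (ℕ.≤-reflexive (≡.sym (ℕ.*-identityˡ d))) (ℕ.*-monoˡ-≤ d (ℕ.≤-pred 1<1+n))
        b+d≤d′ : b ℕ.+ d ℕ.≤ d′
        b+d≤d′ = ℕ.+-monoʳ-≤ b d≤nd
        d≤d′ : d ℕ.≤ d′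
        d≤d′ = ℕ.≤-trans (ℕ.m≤n+m d b) b+d≤d′
        u′≈ : fromℤ (ℤ.- e) * (D * α - C) ≈ v
        u′≈ = trans (*-congʳ (fromℤ-homo-neg e))
          (solve 4 (λ E D α C → (:- E) :* (D :* α :- C) := E :* (C :- D :* α)) refl E D α C)
        v′≈ : fromℤ (ℤ.- e) * (fromℤ c′ - fromℕ d′ * α) ≈ u - N * v
        v′≈ = trans (*-cong (fromℤ-homo-neg e) (+-cong C′≈ (-‿cong (*-congʳ D′≈))))
          (solve 7 (λ E A B C D N α → (:- E) :* (A :+ N :* C :- (B :+ N :* D) :* α)
                      := E :* (B :* α :- A) :- N :* (E :* (C :- D :* α))) refl E A B C D N α)
        nv≤u : N * v ≤ u
        nv≤u = ≤-trans (*-monoˡ-≤ (<⇒≤ 0<err) n≤u/v) (≤-reflexive (*⁻¹-cancelʳ 0<err))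
        u<v+nv : u < (1# + N) * v
        u<v+nv = <-respˡ-≈ (*⁻¹-cancelʳ 0<err) (*-monoˡ-< 0<err u/v<1+n)
        u-nv<v : u - N * v < v
        u-nv<v = <-by (x<y⇒0<y-x u<v+nv)
          (solve 3 (λ u v N → v :- (u :- N :* v) := (:1 :+ N) :* v :- u) refl u v N)
        E²≈1 : E * E ≈ 1#
        E²≈1 = trans (sym (fromℤ-homo-* e e)) (trans (reflexive (≡.cong fromℤ e²≡1)) (+-identityʳ 1#))
        0<u-nv : 0# < u - N * v
        0<u-nv = [ x<y⇒0<y-x , (λ nv≈u → contradiction (d′α≈c′ nv≈u)
                   (irrational⇒qα≉p irrational d′ c′ (ℕ.<-≤-trans 0<d d≤d′))) ]′ nv≤u
          where
          d′α≈c′ : N * v ≈ u → fromℕ d′ * α ≈ fromℤ c′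
          d′α≈c′ nv≈u = begin-equality
            fromℕ d′ * α                 ≈⟨ *-congʳ D′≈ ⟩
            (B + N * D) * α              ≈⟨ *-identityˡ _ ⟨
            1# * ((B + N * D) * α)       ≈⟨ *-congʳ E²≈1 ⟨
            E * E * ((B + N * D) * α)    ≈⟨ solve 7 (λ E A B C D N α → E :* E :* ((B :+ N :* D) :* α)
                := E :* (E :* (B :* α :- A) :- N :* (E :* (C :- D :* α))) :+ E :* E :* (A :+ N :* C))
                refl E A B C D N α ⟩
            E * (u - N * v) + E * E * (A + N * C)  ≈⟨ +-cong (*-congˡ (+-congˡ (-‿cong nv≈u))) (*-cong E²≈1 (sym C′≈)) ⟩
            E * (u - u) + 1# * fromℤ c′  ≈⟨ solve 3 (λ E u c → E :* (u :- u) :+ :1 :* c := c) refl E u (fromℤ c′) ⟩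
            fromℤ c′                     ∎

    convergentsAbove : ∀ k → Convergents α (suc k)
    convergentsAbove zero    = firstConvergents
    convergentsAbove (suc k) = nextConvergents (convergentsAbove k)

  ∣unit∣ : ∀ {e} → e ℤ.* e ≡ + 1 → ∀ x → ∣ fromℤ e * x ∣ ≈ ∣ x ∣
  ∣unit∣ {+ 1} _ x = ∣-∣-cong (trans (*-congʳ (+-identityʳ 1#)) (*-identityˡ x))
  ∣unit∣ { -[1+ 0 ]} _ x = trans (∣-∣-cong (trans (*-congʳ (-‿cong (+-identityʳ 1#))) (-1*x≈-x x))) (∣-x∣≈∣x∣ x)

  -- The Bézout relation is carried because it makes r an inverse of p modulo q, so that p i ≡ l
  -- modulo q can be solved explicitly for i.
  record GoodApproximation (α : Carrier) (q : ℕ) : Set where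
    constructor goodApproximation
    field
      p r s  : ℤ
      bézout : p ℤ.* r ℤ.- + q ℤ.* s ≡ + 1
      0<q    : 0 ℕ.< q
      error  : fromℕ q * ∣ fromℕ q * α - fromℤ p ∣ ≤ 1#

  -- For the errors u > v of the two convergents the determinant relation reads d u + b v = 1,
  -- whence d v ≤ 1. The index is k + k because b ≤ d turns k + k ≤ b + d into k ≤ d.
  convergent-good : ∀ {α k} → Convergents α (k ℕ.+ k) → ∃ λ q → k ℕ.≤ q × GoodApproximation α q
  convergent-good {α} {k} (convergents b d a c e e²≡1 det 0<d b≤d k≤b+d 0<err err<) =
    d , ℕ.≮⇒≥ (λ d<k → ℕ.<⇒≱ (ℕ.+-mono-<-≤ d<k (ℕ.<⇒≤ d<k)) (ℕ.≤-trans k≤b+d (ℕ.+-monoˡ-≤ d b≤d))) ,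
    goodApproximation c (e ℤ.* + b) (e ℤ.* a)
      (≡.trans (solveℤ 5 (λ a b c d e → c :*ℤ (e :*ℤ b) :-ℤ d :*ℤ (e :*ℤ a) :=ℤ e :*ℤ (b :*ℤ c :-ℤ a :*ℤ d))
        ≡.refl a (+ b) c (+ d) e) det)
      0<d
      (begin
        D * ∣ D * α - C ∣        ≈⟨ *-congˡ ∣err∣≈v ⟩
        D * v                    ≤⟨ *-monoʳ-≤ (fromℕ-nonneg d) (<⇒≤ err<) ⟩
        D * u                    ≤⟨ ≤-by (*-nonneg (fromℕ-nonneg b) (<⇒≤ 0<err)) 1-du≈bv ⟩
        1#                       ∎)
    where
    E A B C D u v : Carrier
    E = fromℤ e
    A = fromℤ a
    B = fromℕ b
    C = fromℤ c
    D = fromℕ d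
    u = E * (B * α - A)
    v = E * (C - D * α)
    ∣err∣≈v : ∣ D * α - C ∣ ≈ v
    ∣err∣≈v = begin-equality
      ∣ D * α - C ∣      ≈⟨ ∣-∣-cong (solve 3 (λ C D α → D :* α :- C := :- (C :- D :* α)) refl C D α) ⟩
      ∣ - (C - D * α) ∣  ≈⟨ ∣-x∣≈∣x∣ _ ⟩
      ∣ C - D * α ∣      ≈⟨ ∣unit∣ {e} e²≡1 _ ⟨
      ∣ v ∣              ≈⟨ 0≤x⇒∣x∣≈x (<⇒≤ 0<err) ⟩
      v                  ∎
    det≈1 : E * (B * C - A * D) ≈ 1#
    det≈1 = begin-equality
      E * (B * C - A * D)   ≈⟨ *-congˡ (+-cong (fromℤ-homo-* (+ b) c)
          (trans (fromℤ-homo-neg (a ℤ.* + d)) (-‿cong (fromℤ-homo-* a (+ d))))) ⟨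
      E * (fromℤ (+ b ℤ.* c) + fromℤ (ℤ.- (a ℤ.* + d)))
        ≈⟨ *-congˡ (fromℤ-homo-+ (+ b ℤ.* c) (ℤ.- (a ℤ.* + d))) ⟨
      E * fromℤ (+ b ℤ.* c ℤ.- a ℤ.* + d)     ≈⟨ fromℤ-homo-* e (+ b ℤ.* c ℤ.- a ℤ.* + d) ⟨
      fromℤ (e ℤ.* (+ b ℤ.* c ℤ.- a ℤ.* + d)) ≡⟨ ≡.cong fromℤ det ⟩
      1# + 0#               ≈⟨ +-identityʳ 1# ⟩
      1#                    ∎
    1-du≈bv : 1# - D * u ≈ B * v
    1-du≈bv = trans (+-congʳ (sym det≈1))
      (solve 6 (λ E A B C D α → E :* (B :* C :- A :* D) :- D :* (E :* (B :* α :- A)) := B :* (E :* (C :- D :* α)))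
        refl E A B C D α)

  -- A fraction p/q in lowest terms with ∣q α - p∣ ≤ 1/q places the q points
  -- (N + i) α, 0 ≤ i < q, within 1/q of translates of the q-th parts of the circle.
  equidistribution : ∀ {α q} → GoodApproximation α q → ∀ N z →
    ∃ λ i → i ℕ.< q × ∃ λ m → fromℕ q * ∣ fromℕ (N ℕ.+ i) * α - z - fromℤ m ∣ ≤ 2#
  equidistribution {α} {q@(suc _)} (goodApproximation p r s bézout 0<q error) N z =
    residue (floor (fromℕ q * (z - fromℕ N * α)))
    where
    Q w : Carrier
    Q = fromℕ q
    w = Q * (z - fromℕ N * α)
    residue : (∃ λ l → fromℤ l ≤ w × w < 1# + fromℤ l) →
      ∃ λ i → i ℕ.< q × ∃ λ m → Q * ∣ fromℕ (N ℕ.+ i) * α - z - fromℤ m ∣ ≤ 2#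
    -- The index i should satisfy p i ≡ l modulo q for l = ⌊w⌋. As r inverts p, it is the residue of
    -- l r.
    residue (l , l≤w , w<1+l) = solution (l ℤ.* r ℤ.%ℕ q) (l ℤ.* r ℤ./ℕ q)
      (ℤ.n%ℕd<d (l ℤ.* r) q) (ℤ.a≡a%ℕn+[a/ℕn]*n (l ℤ.* r) q)
      where
      solution : ∀ i t → i ℕ.< q → l ℤ.* r ≡ + i ℤ.+ t ℤ.* + q →
        ∃ λ i → i ℕ.< q × ∃ λ m → Q * ∣ fromℕ (N ℕ.+ i) * α - z - fromℤ m ∣ ≤ 2#
      solution i t i<q lr≡ = i , i<q , m , (begin
        Q * ∣ fromℕ (N ℕ.+ i) * α - z - fromℤ m ∣     ≈⟨ ∣x*y∣≈x*∣y∣ _ (fromℕ-nonneg q) ⟨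
        ∣ Q * (fromℕ (N ℕ.+ i) * α - z - fromℤ m) ∣   ≈⟨ ∣-∣-cong split ⟩
        ∣ (fromℤ l - w) + I * (Q * α - P) ∣            ≤⟨ ∣x+y∣≤∣x∣+∣y∣ _ _ ⟩
        ∣ fromℤ l - w ∣ + ∣ I * (Q * α - P) ∣          ≤⟨ +-mono-≤ ∣l-w∣≤1 ∣I*∣≤1 ⟩
        2#                                              ∎)
        where
        m : ℤ
        m = l ℤ.* s ℤ.- t ℤ.* p
        I P M : Carrier
        I = fromℕ i
        P = fromℤ p
        M = fromℤ m
        pi≡ : p ℤ.* + i ≡ l ℤ.+ + q ℤ.* m
        pi≡ = ≡.trans
          (solveℤ 4 (λ p i t q → p :*ℤ i :=ℤ p :*ℤ (i :+ℤ t :*ℤ q) :-ℤ p :*ℤ (t :*ℤ q)) ≡.refl p (+ i) t (+ q))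
          (≡.trans (≡.cong (λ x → p ℤ.* x ℤ.- p ℤ.* (t ℤ.* + q)) (≡.sym lr≡))
          (≡.trans (solveℤ 6 (λ p q r s t l → p :*ℤ (l :*ℤ r) :-ℤ p :*ℤ (t :*ℤ q)
              :=ℤ l :*ℤ (p :*ℤ r :-ℤ q :*ℤ s) :+ℤ q :*ℤ (l :*ℤ s :-ℤ t :*ℤ p)) ≡.refl p (+ q) r s t l)
          (≡.trans (≡.cong (λ x → l ℤ.* x ℤ.+ + q ℤ.* m) bézout)
          (≡.cong (ℤ._+ + q ℤ.* m) (ℤ.*-identityʳ l)))))
        PI≈ : P * I ≈ fromℤ l + Q * M
        PI≈ = trans (sym (fromℤ-homo-* p (+ i))) (trans (reflexive (≡.cong fromℤ pi≡))
          (trans (fromℤ-homo-+ l (+ q ℤ.* m)) (+-congˡ (fromℤ-homo-* (+ q) m))))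
        -- The bound 2 has two sources, each contributing at most 1: rounding `w` to `l`, and i < q
        -- copies of the error q α - p.
        split : Q * (fromℕ (N ℕ.+ i) * α - z - M) ≈ (fromℤ l - w) + I * (Q * α - P)
        split = begin-equality
          Q * (fromℕ (N ℕ.+ i) * α - z - M)
            ≈⟨ *-congˡ (+-congʳ (+-congʳ (*-congʳ (fromℕ-homo-+ N i)))) ⟩
          Q * ((fromℕ N + I) * α - z - M)
            ≈⟨ solve 8 (λ Q N I α z M P l → Q :* ((N :+ I) :* α :- z :- M)
                 := (l :- Q :* (z :- N :* α)) :+ I :* (Q :* α :- P) :+ (P :* I :- (l :+ Q :* M)))
                 refl Q (fromℕ N) I α z M P (fromℤ l) ⟩
          (fromℤ l - w) + I * (Q * α - P) + (P * I - (fromℤ l + Q * M))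
            ≈⟨ +-congˡ (trans (+-congʳ PI≈) (-‿inverseʳ _)) ⟩
          (fromℤ l - w) + I * (Q * α - P) + 0#
            ≈⟨ +-identityʳ _ ⟩
          (fromℤ l - w) + I * (Q * α - P)  ∎
        ∣l-w∣≤1 : ∣ fromℤ l - w ∣ ≤ 1#
        ∣l-w∣≤1 = ∣x∣≤
          (≤-by (+-nonneg 0≤1 (x≤y⇒0≤y-x l≤w)) (solve 2 (λ l w → :1 :- (l :- w) := :1 :+ (w :- l)) refl (fromℤ l) w))
          (<⇒≤ (<-by (x<y⇒0<y-x w<1+l) (solve 2 (λ l w → :1 :- :- (l :- w) := :1 :+ l :- w) refl (fromℤ l) w)))
        ∣I*∣≤1 : ∣ I * (Q * α - P) ∣ ≤ 1#
        ∣I*∣≤1 = begin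
          ∣ I * (Q * α - P) ∣    ≈⟨ ∣x*y∣≈x*∣y∣ _ (fromℕ-nonneg i) ⟩
          I * ∣ Q * α - P ∣      ≤⟨ *-monoˡ-≤ (0≤∣x∣ _) (fromℕ-mono-≤ (ℕ.<⇒≤ i<q)) ⟩
          Q * ∣ Q * α - P ∣      ≤⟨ error ⟩
          1#                     ∎

  -- Hitting the target scale

  -- Multiplicativity reduces this to continuity at 1: t ≤ (σ y)ᵃ = σᵃ u, and σᵃ ≤ τ. The resulting
  -- σ works for bases of any size.
  isPow-stable : ∀ {a τ} → 0# ≤ a → 1# < τ → ∃ λ σ → 1# < σ ×
    (∀ {x y t u} → 1# ≤ x → 1# ≤ y → x ≤ σ * y → IsPow x a t → IsPow y a u → t ≤ τ * u)
  isPow-stable {a} {τ} 0≤a 1<τ = stable (isPow-continuous-at-1 {a} 1<τ)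
    where
    stable : (∃ λ σ → 1# < σ × (∀ {x t} → 1# ≤ x → x ≤ σ → IsPow x a t → t ≤ τ)) → ∃ λ σ → 1# < σ ×
      (∀ {x y t u} → 1# ≤ x → 1# ≤ y → x ≤ σ * y → IsPow x a t → IsPow y a u → t ≤ τ * u)
    stable (σ , 1<σ , near) = σ , 1<σ , λ {x} {y} {t} {u} 1≤x 1≤y x≤σy p q →
      ≤-trans (isPow-mono 0≤a 1≤x x≤σy p (isPow-* (<⇒≤ 1<σ) 1≤y (isPow-1≤ 0≤a σᵃ) (isPow-1≤ 0≤a q) σᵃ q))
        (*-monoˡ-≤ (1≤⇒0≤ (isPow-1≤ 0≤a q)) (near (<⇒≤ 1<σ) ≤-refl σᵃ))
      where
      σᵃ : IsPow σ a (pow≥1 σ a)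
      σᵃ = pow≥1-isPow (<⇒≤ 1<σ) 0≤a

  -- This is growth relative to the exponent 0, whose power is 1.
  isPow-large : ∀ {a A} → 0# < a → 0# < A → ∀ K → ∃ λ X → 1# ≤ X ×
    (∀ {x t} → X ≤ x → IsPow x a t → K ≤ A * t)
  isPow-large {a} {A} 0<a 0<A K = large (isPow-growth ≤-refl 0<a (K / A))
    where
    large : (∃ λ X → 1# ≤ X × (∀ {x t u} → X ≤ x → IsPow x 0# t → IsPow x a u → K / A * t ≤ u)) →
      ∃ λ X → 1# ≤ X × (∀ {x t} → X ≤ x → IsPow x a t → K ≤ A * t)
    large (X , 1≤X , grows) = X , 1≤X , λ {x} {t} X≤x p → begin
      K              ≈⟨ *⁻¹-cancelʳ 0<A ⟨
      K / A * A      ≈⟨ *-comm _ A ⟩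
      A * (K / A)    ≤⟨ *-monoʳ-≤ (<⇒≤ 0<A) (≤-trans (≤-reflexive (sym (*-identityʳ _)))
                          (grows X≤x (isPow-zero (≤-trans 1≤X X≤x)) p)) ⟩
      A * t          ∎

  -- The solution X of Xᵇ = A xᵃ with a < b tends to infinity with x, but more
  -- slowly than x.
  record Scale (a b A K Y x : Carrier) : Set where
    constructor scale
    field
      v X   : Carrier
      v-pow : IsPow x a v
      X-pow : IsPow X b (A * v)
      1≤X   : 1# ≤ X
      K≤X   : K ≤ X
      X≤Y   : X ≤ Y

  -- Since A xᵃ tends to infinity, it exceeds K′ᵇ, which gives K ≤ X. On the other side A xᵃ ≤ A Lᵃ
  -- Yᵃ, and Yᵇ exceeds this for large Y because a < b, which gives X ≤ Y. The constant L is the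
  -- permitted ratio of x to Y.
  scale-exists : ∀ {a b A L} K → 0# < a → a < b → 0# < A → 1# ≤ L → ∃ λ Y₀ → 1# ≤ Y₀ ×
    (∀ {Y x} → Y₀ ≤ Y → Y₀ ≤ x → x ≤ L * Y → Scale a b A K Y x)
  scale-exists {a} {b} {A} {L} K 0<a a<b 0<A 1≤L = combine (maximum K 1#)
    where
    0≤a : 0# ≤ a
    0≤a = <⇒≤ 0<a
    0<b : 0# < b
    0<b = <-trans 0<a a<b
    0≤b : 0# ≤ b
    0≤b = <⇒≤ 0<b
    Lᵃ : IsPow L a (pow≥1 L a)
    Lᵃ = pow≥1-isPow 1≤L 0≤a
    -- The summand 1, here and in the bound on K′ᵇ below, makes the comparisons of b-th powers
    -- strict, as needed to use `isPow-mono` in contrapositive form.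
    M : Carrier
    M = 1# + A * pow≥1 L a
    Goal : Set
    Goal = ∃ λ Y₀ → 1# ≤ Y₀ × (∀ {Y x} → Y₀ ≤ Y → Y₀ ≤ x → x ≤ L * Y → Scale a b A K Y x)
    combine : (∃ λ K′ → K ≤ K′ × 1# ≤ K′) → Goal
    combine (K′ , K≤K′ , 1≤K′) = combine′ (isPow-large 0<a 0<A (1# + pow≥1 K′ b)) (isPow-growth 0≤a a<b M)
      where
      K′ᵇ : IsPow K′ b (pow≥1 K′ b)
      K′ᵇ = pow≥1-isPow 1≤K′ 0≤b
      combine′ : (∃ λ X₁ → 1# ≤ X₁ × (∀ {x t} → X₁ ≤ x → IsPow x a t → 1# + pow≥1 K′ b ≤ A * t)) →
        (∃ λ X₂ → 1# ≤ X₂ × (∀ {x t u} → X₂ ≤ x → IsPow x a t → IsPow x b u → M * t ≤ u)) → Goal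
      combine′ (X₁ , 1≤X₁ , large) (X₂ , 1≤X₂ , grows) = combine″ (maximum X₁ X₂)
        where
        combine″ : (∃ λ Y₀ → X₁ ≤ Y₀ × X₂ ≤ Y₀) → Goal
        combine″ (Y₀ , X₁≤Y₀ , X₂≤Y₀) = Y₀ , ≤-trans 1≤X₁ X₁≤Y₀ , scaled
          where
          scaled : ∀ {Y x} → Y₀ ≤ Y → Y₀ ≤ x → x ≤ L * Y → Scale a b A K Y x
          scaled {Y} {x} Y₀≤Y Y₀≤x x≤LY = scale v X xᵃ Xᵇ 1≤X (≤-trans K≤K′ K′≤X) X≤Y
            where
            X₁≤x : X₁ ≤ x
            X₁≤x = ≤-trans X₁≤Y₀ Y₀≤x
            X₂≤Y : X₂ ≤ Y
            X₂≤Y = ≤-trans X₂≤Y₀ Y₀≤Y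
            1≤x : 1# ≤ x
            1≤x = ≤-trans 1≤X₁ X₁≤x
            1≤Y : 1# ≤ Y
            1≤Y = ≤-trans 1≤X₂ X₂≤Y
            v X : Carrier
            v = pow≥1 x a
            X = pow≥1 (A * v) (b ⁻¹)
            xᵃ : IsPow x a v
            xᵃ = pow≥1-isPow 1≤x 0≤a
            K′ᵇ<Av : pow≥1 K′ b < A * v
            K′ᵇ<Av = <-≤-trans (x<1+x _) (large X₁≤x xᵃ)
            1≤Av : 1# ≤ A * v
            1≤Av = ≤-trans (isPow-1≤ 0≤b K′ᵇ) (<⇒≤ K′ᵇ<Av)
            0≤b⁻¹ : 0# ≤ b ⁻¹
            0≤b⁻¹ = <⇒≤ (⁻¹-pos 0<b)
            X-root : IsPow (A * v) (b ⁻¹) X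
            X-root = pow≥1-isPow 1≤Av 0≤b⁻¹
            Xᵇ : IsPow X b (A * v)
            Xᵇ = isPow-inverse 0<b X-root
            1≤X : 1# ≤ X
            1≤X = isPow-1≤ 0≤b⁻¹ X-root
            K′≤X : K′ ≤ X
            K′≤X = ≮⇒≥ λ X<K′ → <⇒≱ K′ᵇ<Av (isPow-mono 0≤b 1≤X (<⇒≤ X<K′) Xᵇ K′ᵇ)
            Yᵃ : IsPow Y a (pow≥1 Y a)
            Yᵃ = pow≥1-isPow 1≤Y 0≤a
            Yᵇ : IsPow Y b (pow≥1 Y b)
            Yᵇ = pow≥1-isPow 1≤Y 0≤b
            v≤LᵃYᵃ : v ≤ pow≥1 L a * pow≥1 Y a
            v≤LᵃYᵃ = isPow-mono 0≤a 1≤x x≤LY xᵃ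
              (isPow-* 1≤L 1≤Y (isPow-1≤ 0≤a Lᵃ) (isPow-1≤ 0≤a Yᵃ) Lᵃ Yᵃ)
            Av<Yᵇ : A * v < pow≥1 Y b
            Av<Yᵇ = begin-strict
              A * v                          ≤⟨ *-monoʳ-≤ (<⇒≤ 0<A) v≤LᵃYᵃ ⟩
              A * (pow≥1 L a * pow≥1 Y a)    ≈⟨ *-assoc _ _ _ ⟨
              A * pow≥1 L a * pow≥1 Y a      <⟨ *-monoˡ-< (1≤⇒0< (isPow-1≤ 0≤a Yᵃ)) (x<1+x _) ⟩
              M * pow≥1 Y a                  ≤⟨ grows X₂≤Y Yᵃ Yᵇ ⟩
              pow≥1 Y b                      ∎
            X≤Y : X ≤ Y
            X≤Y = ≮⇒≥ λ Y<X → <⇒≱ Av<Yᵇ (isPow-mono 0≤b 1≤Y (<⇒≤ Y<X) Yᵇ Xᵇ)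

  -- Signs, and relative perturbations of a point

  IsSign : Carrier → Set
  IsSign S = S ≈ 1# ⊎ S ≈ - 1#

  ∣S*x∣≈∣x∣ : ∀ {S} → IsSign S → ∀ x → ∣ S * x ∣ ≈ ∣ x ∣
  ∣S*x∣≈∣x∣ (inj₁ S≈1)  x = ∣-∣-cong (trans (*-congʳ S≈1) (*-identityˡ x))
  ∣S*x∣≈∣x∣ (inj₂ S≈-1) x = trans (∣-∣-cong (trans (*-congʳ S≈-1) (-1*x≈-x x))) (∣-x∣≈∣x∣ x)

  S*S≈1 : ∀ {S} → IsSign S → S * S ≈ 1#
  S*S≈1 (inj₁ S≈1)  = trans (*-cong S≈1 S≈1) (*-identityˡ 1#)
  S*S≈1 (inj₂ S≈-1) = trans (*-cong S≈-1 S≈-1) (solve 0 (:- :1 :* :- :1 := :1) refl)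

  sgn-unique : ∀ {S x} → IsSign S → 0# < S * x → sgn x ≈ S
  sgn-unique {S} {x} S-sign 0<Sx with compare x 0# | S-sign
  ... | tri< _ _ _   | inj₂ S≈-1 = sym S≈-1
  ... | tri> _ _ _   | inj₁ S≈1  = sym S≈1
  ... | tri≈ _ x≈0 _ | _         = contradiction (trans (*-congˡ x≈0) (zeroʳ S)) (0<⇒≉0 0<Sx)
  ... | tri< x<0 _ _ | inj₁ S≈1  = contradiction
    (<-respʳ-≈ (trans (*-congʳ S≈1) (*-identityˡ x)) 0<Sx) (<-asym x<0)
  ... | tri> _ _ 0<x | inj₂ S≈-1 = contradiction
    (<-respʳ-≈ (trans (*-congʳ S≈-1) (-1*x≈-x x)) 0<Sx) (<-asym (<-respʳ-≈ -0≈0 (neg-antimono-< 0<x)))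

  ⁻¹-swap-≤ : ∀ {x y s} → 0# < x → 0# < y → x ⁻¹ ≤ s * y → y ⁻¹ ≤ s * x
  ⁻¹-swap-≤ {x} {y} {s} 0<x 0<y x⁻¹≤sy = begin
    y ⁻¹                ≈⟨ *⁻¹-cancelʳ 0<x ⟨
    y ⁻¹ * x ⁻¹ * x     ≤⟨ *-monoˡ-≤ (<⇒≤ 0<x) (*-monoʳ-≤ (<⇒≤ (⁻¹-pos 0<y)) x⁻¹≤sy) ⟩
    y ⁻¹ * (s * y) * x  ≈⟨ solve 4 (λ x y z s → z :* (s :* y) :* x := s :* x :* z :* y) refl x y (y ⁻¹) s ⟩
    s * x * y ⁻¹ * y    ≈⟨ *⁻¹-cancelʳ 0<y ⟩
    s * x               ∎

  -- The bound on e is just what puts S x above z / σ. It also puts S x below σ z, because (σ - 1)(1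
  -- - σ⁻¹) ≥ 0 means 2 - σ⁻¹ ≤ σ.
  module _ {S σ z e x : Carrier} (S-sign : IsSign S) (1<σ : 1# < σ) (0<z : 0# < z)
           (∣e∣≤ : ∣ e ∣ ≤ (1# - σ ⁻¹) * z) (x≈ : x ≈ S * z + e) where

    private
      0<σ : 0# < σ
      0<σ = <-trans 0<1 1<σ
      Sx≈ : S * x ≈ z + S * e
      Sx≈ = begin-equality
        S * x              ≈⟨ *-congˡ x≈ ⟩
        S * (S * z + e)    ≈⟨ solve 3 (λ S z e → S :* (S :* z :+ e) := S :* S :* z :+ S :* e) refl S z e ⟩
        S * S * z + S * e  ≈⟨ +-congʳ (trans (*-congʳ (S*S≈1 S-sign)) (*-identityˡ z)) ⟩
        z + S * e          ∎
      ∣Se∣≤ : ∣ S * e ∣ ≤ (1# - σ ⁻¹) * z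
      ∣Se∣≤ = ≤-trans (≤-reflexive (∣S*x∣≈∣x∣ S-sign e)) ∣e∣≤
      z/σ≤Sx : σ ⁻¹ * z ≤ S * x
      z/σ≤Sx = ≤-by (x≤y⇒0≤y-x (≤-trans (-x≤∣x∣ _) ∣Se∣≤)) (trans (+-congʳ Sx≈)
        (solve 3 (λ ω z e → z :+ e :- ω :* z := (:1 :- ω) :* z :- :- e) refl (σ ⁻¹) z (S * e)))
      Sx≤σz : S * x ≤ σ * z
      Sx≤σz = begin
        S * x                       ≈⟨ Sx≈ ⟩
        z + S * e                   ≤⟨ +-mono-≤ ≤-refl (≤-trans (x≤∣x∣ _) ∣Se∣≤) ⟩
        z + (1# - σ ⁻¹) * z         ≤⟨ ≤-by (*-nonneg (*-nonneg (<⇒≤ (x<y⇒0<y-x 1<σ)) (<⇒≤ (x<y⇒0<y-x (⁻¹<1 1<σ)))) (<⇒≤ 0<z))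
            (solve 3 (λ σ ω z → σ :* z :+ (:1 :- σ :* ω) :* z :- (z :+ (:1 :- ω) :* z)
                        := (σ :- :1) :* (:1 :- ω) :* z) refl σ (σ ⁻¹) z) ⟩
        σ * z + (1# - σ * σ ⁻¹) * z ≈⟨ +-congˡ (trans (*-congʳ (trans (+-congˡ (-‿cong
                                         (⁻¹-inverseʳ (0<⇒≉0 0<σ)))) (-‿inverseʳ 1#))) (zeroˡ z)) ⟩
        σ * z + 0#                  ≈⟨ +-identityʳ _ ⟩
        σ * z                       ∎

    perturb-sign : 0# < S * x
    perturb-sign = <-≤-trans (*-pos (⁻¹-pos 0<σ) 0<z) z/σ≤Sx

    private
      ∣x∣≈Sx : ∣ x ∣ ≈ S * x
      ∣x∣≈Sx = trans (sym (∣S*x∣≈∣x∣ S-sign x)) (0≤x⇒∣x∣≈x (<⇒≤ perturb-sign))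

    perturb-upper : ∣ x ∣ ≤ σ * z
    perturb-upper = ≤-trans (≤-reflexive ∣x∣≈Sx) Sx≤σz

    perturb-lower : z ≤ σ * ∣ x ∣
    perturb-lower = begin
      z                ≈⟨ *⁻¹-cancelʳ 0<σ ⟨
      z * σ ⁻¹ * σ     ≈⟨ solve 3 (λ z ω σ → z :* ω :* σ := σ :* (ω :* z)) refl z (σ ⁻¹) σ ⟩
      σ * (σ ⁻¹ * z)   ≤⟨ *-monoʳ-≤ (<⇒≤ 0<σ) (≤-trans z/σ≤Sx (≤-reflexive (sym ∣x∣≈Sx))) ⟩
      σ * ∣ x ∣        ∎

  -- A point k α = r + x + m with sgn x = S at which A kᵝ ∣x∣ᵞ is within a
  -- factor τ of 1.
  record Hit (α r S A β γ τ η T : Carrier) : Set where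
    constructor hit
    field
      k        : ℕ
      m        : ℤ
      x        : Carrier
      kα≈      : fromℕ k * α ≈ r + x + fromℤ m
      0<k      : 0 ℕ.< k
      T<k      : T < fromℕ k
      0<Sx     : 0# < S * x
      ∣x∣<η    : ∣ x ∣ < η
      -- Here X stands for ∣x∣ to the power - γ. Quantifying over all witnesses lets the values of
      -- `_^ʳ_` be inserted later.
      balanced : ∀ {t X} → IsPow (fromℕ k) β t → IsPow (∣ x ∣ ⁻¹) γ X →
                 A * t ≤ τ * X × X ≤ τ * (A * t)

  Stable : Carrier → Carrier → Carrier → Set
  Stable a τ σ = ∀ {x y t u} → 1# ≤ x → 1# ≤ y → x ≤ σ * y → IsPow x a t → IsPow y a u → t ≤ τ * u

  0<Sx⇒0<∣x∣ : ∀ {S x} → IsSign S → 0# < S * x → 0# < ∣ x ∣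
  0<Sx⇒0<∣x∣ S-sign 0<Sx = <-≤-trans 0<Sx (≤-trans (x≤∣x∣ _) (≤-reflexive (∣S*x∣≈∣x∣ S-sign _)))

  -- As k runs through [N q , (N + 1) q), kᵝ changes by a factor at most ρ when N
  -- is large, while q ∣x - S X⁻¹∣ ≤ 2 can be arranged for any X; since β < γ the
  -- solution X of Xᵞ = A (N q)ᵝ is small compared to q, so x is close to S X⁻¹.
  module _ {α r S A β γ τ η T : Carrier} (S-sign : IsSign S) (0<A : 0# < A) (0<β : 0# < β) (β<γ : β < γ)
           (0<η : 0# < η) (η≤1 : η ≤ 1#)
           {ρ} (1<ρ : 1# < ρ) (ρρ≤τ : ρ * ρ ≤ τ)
           {σ₁} (stable₁ : Stable β ρ σ₁)
           {σ₂} (1<σ₂ : 1# < σ₂) (stable₂ : Stable γ ρ σ₂)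
           {N : ℕ} (1≤N : 1 ℕ.≤ N) (1+N≤σ₁N : 1# + fromℕ N ≤ σ₁ * fromℕ N) where

    private
      0<σ₂ : 0# < σ₂
      0<σ₂ = <-trans 0<1 1<σ₂
      -- κ is the relative error in X⁻¹ tolerated by the perturbation lemmas for σ₂. With h = κ / 2,
      -- the bound X ≤ h q gives 2 / q ≤ κ / X, which absorbs the error of equidistribution.
      κ : Carrier
      κ = 1# - σ₂ ⁻¹
      h : Carrier
      h = κ / 2#

    hit-near : ∀ {q K} → GoodApproximation α q → T < fromℕ q → σ₂ / η < K →
      1# ≤ fromℕ (N ℕ.* q) → Scale β γ A K (h * fromℕ q) (fromℕ (N ℕ.* q)) → Hit α r S A β γ τ η T
    hit-near {q} {K} approximation T<q σ₂/η<K 1≤Nq (scale v X v-pow X-pow 1≤X K≤X X≤Y) =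
      near (equidistribution approximation (N ℕ.* q) (r + S * X ⁻¹))
      where
      0<q : 0 ℕ.< q
      0<q = GoodApproximation.0<q approximation
      Q : Carrier
      Q = fromℕ q
      0<Q : 0# < Q
      0<Q = 1≤⇒0< (1≤fromℕ 0<q)
      0<X : 0# < X
      0<X = 1≤⇒0< 1≤X
      near : (∃ λ i → i ℕ.< q × ∃ λ m →
        Q * ∣ fromℕ (N ℕ.* q ℕ.+ i) * α - (r + S * X ⁻¹) - fromℤ m ∣ ≤ 2#) → Hit α r S A β γ τ η T
      near (i , i<q , m , Q∣e∣≤2) = hit k m x kα≈ (ℕ.<-≤-trans 0<q q≤k) (<-≤-trans T<q (fromℕ-mono-≤ q≤k))
        (perturb-sign S-sign 1<σ₂ (⁻¹-pos 0<X) ∣e∣≤ x≈) ∣x∣<η balanced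
        where
        k : ℕ
        k = N ℕ.* q ℕ.+ i
        x e M : Carrier
        M = fromℤ m
        x = fromℕ k * α - r - M
        e = fromℕ k * α - (r + S * X ⁻¹) - M
        q≤Nq : q ℕ.≤ N ℕ.* q
        q≤Nq = ℕ.≤-trans (ℕ.≤-reflexive (≡.sym (ℕ.*-identityˡ q))) (ℕ.*-monoˡ-≤ q 1≤N)
        Nq≤k : N ℕ.* q ℕ.≤ k
        Nq≤k = ℕ.m≤m+n (N ℕ.* q) i
        q≤k : q ℕ.≤ k
        q≤k = ℕ.≤-trans q≤Nq Nq≤k
        kα≈ : fromℕ k * α ≈ r + x + M
        kα≈ = solve 3 (λ y r M → y := r :+ (y :- r :- M) :+ M) refl (fromℕ k * α) r M
        x≈ : x ≈ S * X ⁻¹ + e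
        x≈ = solve 4 (λ y r M z → y :- r :- M := z :+ (y :- (r :+ z) :- M)) refl (fromℕ k * α) r M (S * X ⁻¹)
        ∣e∣≤ : ∣ e ∣ ≤ κ * X ⁻¹
        ∣e∣≤ = ≤-/ 0<X (*-cancelˡ-≤ 0<Q (begin
          Q * (∣ e ∣ * X)    ≈⟨ *-assoc _ _ _ ⟨
          Q * ∣ e ∣ * X      ≤⟨ *-monoˡ-≤ (<⇒≤ 0<X) Q∣e∣≤2 ⟩
          2# * X             ≤⟨ *-monoʳ-≤ (<⇒≤ 0<2) X≤Y ⟩
          2# * (h * Q)       ≈⟨ solve 3 (λ a h q → a :* (h :* q) := q :* (h :* a)) refl 2# h Q ⟩
          Q * (h * 2#)       ≈⟨ *-congˡ (*⁻¹-cancelʳ 0<2) ⟩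
          Q * κ              ∎))
        0<∣x∣ : 0# < ∣ x ∣
        0<∣x∣ = 0<Sx⇒0<∣x∣ S-sign (perturb-sign S-sign 1<σ₂ (⁻¹-pos 0<X) ∣e∣≤ x≈)
        ∣x∣≤σ₂/X : ∣ x ∣ ≤ σ₂ * X ⁻¹
        ∣x∣≤σ₂/X = perturb-upper S-sign 1<σ₂ (⁻¹-pos 0<X) ∣e∣≤ x≈
        ≤∣x∣ : X ⁻¹ ≤ σ₂ * ∣ x ∣
        ≤∣x∣ = perturb-lower S-sign 1<σ₂ (⁻¹-pos 0<X) ∣e∣≤ x≈
        -- The lower bound K on X exceeds σ₂ / η for this purpose: it makes σ₂ / X smaller than η.
        ∣x∣<η : ∣ x ∣ < η
        ∣x∣<η = ≤-<-trans ∣x∣≤σ₂/X (/-< 0<X (begin-strict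
          σ₂            ≈⟨ *⁻¹-cancelʳ 0<η ⟨
          σ₂ / η * η    <⟨ *-monoˡ-< 0<η (<-≤-trans σ₂/η<K K≤X) ⟩
          X * η         ≈⟨ *-comm X η ⟩
          η * X         ∎))
        1≤∣x∣⁻¹ : 1# ≤ ∣ x ∣ ⁻¹
        1≤∣x∣⁻¹ = 1≤⁻¹ 0<∣x∣ (≤-trans (<⇒≤ ∣x∣<η) η≤1)
        ∣x∣⁻¹≤σ₂X : ∣ x ∣ ⁻¹ ≤ σ₂ * X
        ∣x∣⁻¹≤σ₂X = ⁻¹-swap-≤ 0<X 0<∣x∣ ≤∣x∣
        X≤σ₂∣x∣⁻¹ : X ≤ σ₂ * ∣ x ∣ ⁻¹
        X≤σ₂∣x∣⁻¹ = ≤-trans (≤-reflexive (sym (⁻¹-involutive (0<⇒≉0 0<X))))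
          (⁻¹-swap-≤ (⁻¹-pos 0<∣x∣) (⁻¹-pos 0<X) (≤-trans (≤-reflexive (⁻¹-involutive (0<⇒≉0 0<∣x∣))) ∣x∣≤σ₂/X))
        k≤σ₁Nq : fromℕ k ≤ σ₁ * fromℕ (N ℕ.* q)
        k≤σ₁Nq = begin
          fromℕ k                    ≤⟨ fromℕ-mono-≤ (ℕ.+-monoʳ-≤ (N ℕ.* q) (ℕ.<⇒≤ i<q)) ⟩
          fromℕ (N ℕ.* q ℕ.+ q)      ≈⟨ trans (fromℕ-homo-+ (N ℕ.* q) q) (+-congʳ (fromℕ-homo-* N q)) ⟩
          fromℕ N * Q + Q            ≈⟨ solve 2 (λ N Q → N :* Q :+ Q := (:1 :+ N) :* Q) refl (fromℕ N) Q ⟩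
          (1# + fromℕ N) * Q         ≤⟨ *-monoˡ-≤ (<⇒≤ 0<Q) 1+N≤σ₁N ⟩
          σ₁ * fromℕ N * Q           ≈⟨ *-assoc _ _ _ ⟩
          σ₁ * (fromℕ N * Q)         ≈⟨ *-congˡ (fromℕ-homo-* N q) ⟨
          σ₁ * fromℕ (N ℕ.* q)       ∎
        1≤k : 1# ≤ fromℕ k
        1≤k = ≤-trans 1≤Nq (fromℕ-mono-≤ Nq≤k)
        0≤ρ : 0# ≤ ρ
        0≤ρ = 1≤⇒0≤ (<⇒≤ 1<ρ)
        0≤γ : 0# ≤ γ
        0≤γ = <⇒≤ (<-trans 0<β β<γ)
        ρ²≤τ : ∀ {y} → 0# ≤ y → ρ * (ρ * y) ≤ τ * y
        ρ²≤τ 0≤y = ≤-trans (≤-reflexive (sym (*-assoc ρ ρ _))) (*-monoˡ-≤ 0≤y ρρ≤τ)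
        -- One factor ρ pays for replacing k by N q, the other for replacing 1/∣x∣ by X. In the
        -- second inequality k ≥ N q makes the first replacement free, and the spare ρ is only
        -- padding.
        balanced : ∀ {t Z} → IsPow (fromℕ k) β t → IsPow (∣ x ∣ ⁻¹) γ Z → A * t ≤ τ * Z × Z ≤ τ * (A * t)
        balanced {t} {Z} t-pow Z-pow = (begin
            A * t           ≤⟨ *-monoʳ-≤ (<⇒≤ 0<A) (stable₁ 1≤k 1≤Nq k≤σ₁Nq t-pow v-pow) ⟩
            A * (ρ * v)     ≈⟨ solve 3 (λ A ρ v → A :* (ρ :* v) := ρ :* (A :* v)) refl A ρ v ⟩
            ρ * (A * v)     ≤⟨ *-monoʳ-≤ 0≤ρ (stable₂ 1≤X 1≤∣x∣⁻¹ X≤σ₂∣x∣⁻¹ X-pow Z-pow) ⟩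
            ρ * (ρ * Z)     ≤⟨ ρ²≤τ (1≤⇒0≤ (isPow-1≤ 0≤γ Z-pow)) ⟩
            τ * Z           ∎) , (begin
            Z               ≤⟨ stable₂ 1≤∣x∣⁻¹ 1≤X ∣x∣⁻¹≤σ₂X Z-pow X-pow ⟩
            ρ * (A * v)     ≤⟨ *-monoʳ-≤ 0≤ρ Av≤At ⟩
            ρ * (A * t)     ≤⟨ *-monoʳ-≤ 0≤ρ (≤-trans (≤-reflexive (sym (*-identityˡ _))) (*-monoˡ-≤ 0≤At (<⇒≤ 1<ρ))) ⟩
            ρ * (ρ * (A * t)) ≤⟨ ρ²≤τ 0≤At ⟩
            τ * (A * t)     ∎)
          where
          Av≤At : A * v ≤ A * t
          Av≤At = *-monoʳ-≤ (<⇒≤ 0<A) (isPow-mono (<⇒≤ 0<β) 1≤Nq (fromℕ-mono-≤ Nq≤k) v-pow t-pow)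
          0≤At : 0# ≤ A * t
          0≤At = *-nonneg (<⇒≤ 0<A) (1≤⇒0≤ (isPow-1≤ (<⇒≤ 0<β) t-pow))

    hit-scale : Irrational α → Hit α r S A β γ τ η T
    hit-scale irrational = large (scale-exists (1# + σ₂ / η) 0<β β<γ 0<A 1≤L)
      where
      0<κ : 0# < κ
      0<κ = x<y⇒0<y-x (⁻¹<1 1<σ₂)
      0<h : 0# < h
      0<h = *-pos 0<κ (⁻¹-pos 0<2)
      h≤1 : h ≤ 1#
      h≤1 = /-≤ 0<2 (≤-by (+-nonneg (<⇒≤ (⁻¹-pos 0<σ₂)) 0≤1)
        (solve 1 (λ ω → :1 :* :2 :- (:1 :- ω) := ω :+ :1) refl (σ₂ ⁻¹)))
      -- The scale is used with base N q and bound Y = h q, whose ratio is N / h.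
      L : Carrier
      L = fromℕ N / h
      1≤L : 1# ≤ L
      1≤L = ≤-/ 0<h (≤-trans (≤-reflexive (*-identityˡ h)) (≤-trans h≤1 (1≤fromℕ 1≤N)))
      large : (∃ λ Y₀ → 1# ≤ Y₀ × (∀ {Y x} → Y₀ ≤ Y → Y₀ ≤ x → x ≤ L * Y → Scale β γ A (1# + σ₂ / η) Y x)) →
        Hit α r S A β γ τ η T
      -- A single threshold for q: exceeding T makes k exceed T, and exceeding Y₀ / h makes h q and
      -- N q large enough for the scale.
      large (Y₀ , 1≤Y₀ , scaled) = bound (maximum T (Y₀ / h))
        where
        bound : (∃ λ W → T ≤ W × Y₀ / h ≤ W) → Hit α r S A β γ τ η T
        bound (W , T≤W , Y₀/h≤W) = bound′ (archimedean W)
          where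
          bound′ : (∃ λ n → W < fromℕ n) → Hit α r S A β γ τ η T
          bound′ (n , W<n) = approximated (convergent-good {k = n} (weaken (convergentsAbove irrational (n ℕ.+ n))))
            where
            weaken : ∀ {k} → Convergents α (suc k) → Convergents α k
            weaken (convergents b d a c e e²≡1 det 0<d b≤d k≤b+d 0<err err<) =
              convergents b d a c e e²≡1 det 0<d b≤d (ℕ.≤-trans (ℕ.n≤1+n _) k≤b+d) 0<err err<
            approximated : (∃ λ q → n ℕ.≤ q × GoodApproximation α q) → Hit α r S A β γ τ η T
            approximated (q , n≤q , approximation) =
              hit-near approximation (≤-<-trans T≤W W<q) (x<1+x _) (≤-trans 1≤Y₀ Y₀≤Nq) (scaled Y₀≤hq Y₀≤Nq Nq≤LY)
              where
              W<q : W < fromℕ q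
              W<q = <-≤-trans W<n (fromℕ-mono-≤ n≤q)
              Y₀≤hq : Y₀ ≤ h * fromℕ q
              Y₀≤hq = begin
                Y₀             ≈⟨ *⁻¹-cancelʳ 0<h ⟨
                Y₀ / h * h     ≈⟨ *-comm _ h ⟩
                h * (Y₀ / h)   ≤⟨ *-monoʳ-≤ (<⇒≤ 0<h) (≤-trans Y₀/h≤W (<⇒≤ W<q)) ⟩
                h * fromℕ q    ∎
              Nq≈ : fromℕ (N ℕ.* q) ≈ fromℕ N * fromℕ q
              Nq≈ = fromℕ-homo-* N q
              Y₀≤Nq : Y₀ ≤ fromℕ (N ℕ.* q)
              Y₀≤Nq = begin
                Y₀                 ≤⟨ Y₀≤hq ⟩
                h * fromℕ q        ≤⟨ *-monoˡ-≤ (fromℕ-nonneg q) (≤-trans h≤1 (1≤fromℕ 1≤N)) ⟩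
                fromℕ N * fromℕ q  ≈⟨ Nq≈ ⟨
                fromℕ (N ℕ.* q)    ∎
              Nq≤LY : fromℕ (N ℕ.* q) ≤ L * (h * fromℕ q)
              Nq≤LY = ≤-reflexive (begin-equality
                fromℕ (N ℕ.* q)          ≈⟨ Nq≈ ⟩
                fromℕ N * fromℕ q        ≈⟨ *-congʳ (*⁻¹-cancelʳ 0<h) ⟨
                fromℕ N / h * h * fromℕ q ≈⟨ *-assoc _ _ _ ⟩
                L * (h * fromℕ q)        ∎)

  -- The constants are chosen in order: ρ with ρ² ≤ τ, then σ₁ and σ₂ by stability of the powers for
  -- β and γ, then N > 1 / (σ₁ - 1), which is what 1 + N ≤ σ₁ N requires.
  hit-exists : ∀ {α r S A β γ τ η T} → Irrational α → IsSign S → 0# < A → 0# < β → β < γ → 1# < τ →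
    0# < η → η ≤ 1# → Hit α r S A β γ τ η T
  hit-exists {α} {r} {S} {A} {β} {γ} {τ} {η} {T} irrational S-sign 0<A 0<β β<γ 1<τ 0<η η≤1 =
    root (^-continuous-at-1 2 1<τ)
    where
    root : (∃ λ ρ → 1# < ρ × ρ ^ 2 ≤ τ) → Hit α r S A β γ τ η T
    root (ρ , 1<ρ , ρ²≤τ) = stabilise (isPow-stable (<⇒≤ 0<β) 1<ρ) (isPow-stable (<⇒≤ (<-trans 0<β β<γ)) 1<ρ)
      where
      stabilise : (∃ λ σ → 1# < σ × Stable β ρ σ) → (∃ λ σ → 1# < σ × Stable γ ρ σ) → Hit α r S A β γ τ η T
      stabilise (σ₁ , 1<σ₁ , stable₁) (σ₂ , 1<σ₂ , stable₂) = multiple (archimedean ((σ₁ - 1#) ⁻¹))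
        where
        0<σ₁-1 : 0# < σ₁ - 1#
        0<σ₁-1 = x<y⇒0<y-x 1<σ₁
        multiple : (∃ λ N → (σ₁ - 1#) ⁻¹ < fromℕ N) → Hit α r S A β γ τ η T
        multiple (N , inv<N) = hit-scale S-sign 0<A 0<β β<γ 0<η η≤1 1<ρ
          (≤-trans (*-monoʳ-≤ (1≤⇒0≤ (<⇒≤ 1<ρ)) (≤-reflexive (sym (*-identityʳ ρ)))) ρ²≤τ)
          stable₁ 1<σ₂ stable₂ {N} (fromℕ-cancel-< {0} (<-trans (⁻¹-pos 0<σ₁-1) inv<N))
          (≤-by (x≤y⇒0≤y-x 1≤N[σ₁-1]) (solve 2 (λ σ N → σ :* N :- (:1 :+ N) := (σ :- :1) :* N :- :1) refl σ₁ (fromℕ N)))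
          irrational
          where
          1≤N[σ₁-1] : 1# ≤ (σ₁ - 1#) * fromℕ N
          1≤N[σ₁-1] = ≤-trans (≤-reflexive (sym (⁻¹-inverseʳ (0<⇒≉0 0<σ₁-1)))) (*-monoʳ-≤ (<⇒≤ 0<σ₁-1) (<⇒≤ inv<N))

  -- Density

  periodic-ℕ : ∀ F → 1-Periodic F → ∀ n x → F ⟨ x + fromℕ n ⟩ ≈ F ⟨ x ⟩
  periodic-ℕ F periodic zero    x = Func.cong F (+-identityʳ x)
  periodic-ℕ F periodic (suc n) x = begin-equality
    F ⟨ x + (1# + fromℕ n) ⟩  ≈⟨ Func.cong F (solve 2 (λ x n → x :+ (:1 :+ n) := x :+ n :+ :1) refl x (fromℕ n)) ⟩
    F ⟨ x + fromℕ n + 1# ⟩    ≈⟨ periodic (x + fromℕ n) ⟩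
    F ⟨ x + fromℕ n ⟩         ≈⟨ periodic-ℕ F periodic n x ⟩
    F ⟨ x ⟩                   ∎

  periodic-ℤ : ∀ F → 1-Periodic F → ∀ i x → F ⟨ x + fromℤ i ⟩ ≈ F ⟨ x ⟩
  periodic-ℤ F periodic (+ n)    x = periodic-ℕ F periodic n x
  periodic-ℤ F periodic -[1+ n ] x = begin-equality
    F ⟨ x - fromℕ (suc n) ⟩                  ≈⟨ periodic-ℕ F periodic (suc n) _ ⟨
    F ⟨ x - fromℕ (suc n) + fromℕ (suc n) ⟩
      ≈⟨ Func.cong F (solve 2 (λ x n → x :- n :+ n := x) refl x (fromℕ (suc n))) ⟩
    F ⟨ x ⟩                                  ∎

  8# : Carrier
  8# = 2# * 2# * 2#

  -- As ε ≤ 1, the product p = ∣v∣ ∣u∣ is at most 2 ∣y∣. Three error terms of size ε p and one of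
  -- size ε ∣y∣ add up to 7 ε ∣y∣, rounded up to 8 ε ∣y∣.
  product-error : ∀ {g v f u y ε} → 0# ≤ ε → ε ≤ 1# → ∣ g - v ∣ ≤ ε * ∣ v ∣ → ∣ f - u ∣ ≤ ε * ∣ u ∣ →
    ∣ v * u - y ∣ ≤ ε * ∣ y ∣ → ∣ g * f - y ∣ ≤ 8# * ∣ y ∣ * ε
  product-error {g} {v} {f} {u} {y} {ε} 0≤ε ε≤1 g-v f-u vu-y = begin
    ∣ g * f - y ∣
      ≈⟨ ∣-∣-cong (solve 5 (λ g v f u y → g :* f :- y
           := ((g :- v) :* (f :- u) :+ u :* (g :- v)) :+ (v :* (f :- u) :+ (v :* u :- y))) refl g v f u y) ⟩
    ∣ ((g - v) * (f - u) + u * (g - v)) + (v * (f - u) + (v * u - y)) ∣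
      ≤⟨ ≤-trans (∣x+y∣≤∣x∣+∣y∣ _ _) (+-mono-≤ (∣x+y∣≤∣x∣+∣y∣ _ _) (∣x+y∣≤∣x∣+∣y∣ _ _)) ⟩
    (∣ (g - v) * (f - u) ∣ + ∣ u * (g - v) ∣) + (∣ v * (f - u) ∣ + ∣ v * u - y ∣)
      ≤⟨ +-mono-≤ (+-mono-≤ both left) (+-mono-≤ right vu-y) ⟩
    (ε * p + ε * p) + (ε * p + ε * Y)
      ≤⟨ +-mono-≤ (+-mono-≤ εp εp) (+-mono-≤ εp ≤-refl) ⟩
    (ε * (2# * Y) + ε * (2# * Y)) + (ε * (2# * Y) + ε * Y)
      ≤⟨ ≤-by (*-nonneg 0≤ε (0≤∣x∣ y)) (solve 2 (λ ε Y → :2 :* :2 :* :2 :* Y :* ε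
           :- ((ε :* (:2 :* Y) :+ ε :* (:2 :* Y)) :+ (ε :* (:2 :* Y) :+ ε :* Y)) := ε :* Y) refl ε Y) ⟩
    8# * Y * ε  ∎
    where
    Y p : Carrier
    Y = ∣ y ∣
    p = ∣ v ∣ * ∣ u ∣
    0≤p : 0# ≤ p
    0≤p = *-nonneg (0≤∣x∣ v) (0≤∣x∣ u)
    ε* : ∀ {x} → 0# ≤ x → ε * x ≤ x
    ε* 0≤x = ≤-trans (*-monoˡ-≤ 0≤x ε≤1) (≤-reflexive (*-identityˡ _))
    both : ∣ (g - v) * (f - u) ∣ ≤ ε * p
    both = begin
      ∣ (g - v) * (f - u) ∣          ≈⟨ ∣x*y∣≈∣x∣*∣y∣ _ _ ⟩
      ∣ g - v ∣ * ∣ f - u ∣          ≤⟨ *-mono-≤ (0≤∣x∣ _) (0≤∣x∣ _) g-v f-u ⟩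
      (ε * ∣ v ∣) * (ε * ∣ u ∣)      ≈⟨ solve 3 (λ ε v u → (ε :* v) :* (ε :* u) := ε :* (ε :* (v :* u)))
                                          refl ε ∣ v ∣ ∣ u ∣ ⟩
      ε * (ε * p)                    ≤⟨ ε* (*-nonneg 0≤ε 0≤p) ⟩
      ε * p                          ∎
    left : ∣ u * (g - v) ∣ ≤ ε * p
    left = begin
      ∣ u * (g - v) ∣        ≈⟨ ∣x*y∣≈∣x∣*∣y∣ _ _ ⟩
      ∣ u ∣ * ∣ g - v ∣      ≤⟨ *-monoʳ-≤ (0≤∣x∣ u) g-v ⟩
      ∣ u ∣ * (ε * ∣ v ∣)    ≈⟨ solve 3 (λ ε v u → u :* (ε :* v) := ε :* (v :* u)) refl ε ∣ v ∣ ∣ u ∣ ⟩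
      ε * p                  ∎
    right : ∣ v * (f - u) ∣ ≤ ε * p
    right = begin
      ∣ v * (f - u) ∣        ≈⟨ ∣x*y∣≈∣x∣*∣y∣ _ _ ⟩
      ∣ v ∣ * ∣ f - u ∣      ≤⟨ *-monoʳ-≤ (0≤∣x∣ v) f-u ⟩
      ∣ v ∣ * (ε * ∣ u ∣)    ≈⟨ solve 3 (λ ε v u → v :* (ε :* u) := ε :* (v :* u)) refl ε ∣ v ∣ ∣ u ∣ ⟩
      ε * p                  ∎
    p≤2Y : p ≤ 2# * Y
    p≤2Y = begin
      p                        ≈⟨ ∣x*y∣≈∣x∣*∣y∣ v u ⟨
      ∣ v * u ∣                ≈⟨ ∣-∣-cong (solve 3 (λ v u y → v :* u := (v :* u :- y) :+ y) refl v u y) ⟩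
      ∣ (v * u - y) + y ∣      ≤⟨ ∣x+y∣≤∣x∣+∣y∣ _ _ ⟩
      ∣ v * u - y ∣ + Y        ≤⟨ +-mono-≤ (≤-trans vu-y (ε* (0≤∣x∣ y))) ≤-refl ⟩
      Y + Y                    ≈⟨ solve 1 (λ Y → Y :+ Y := :2 :* Y) refl Y ⟩
      2# * Y                   ∎
    εp : ε * p ≤ ε * (2# * Y)
    εp = *-monoʳ-≤ 0≤ε p≤2Y

  small-factor : ∀ K {δ} → 0# < δ → ∃ λ ε → 0# < ε × ε ≤ 1# × K * ε < δ
  small-factor K {δ} 0<δ = small (maximum 1# (1# + K / δ))
    where
    small : (∃ λ M → 1# ≤ M × 1# + K / δ ≤ M) → ∃ λ ε → 0# < ε × ε ≤ 1# × K * ε < δ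
    small (M , 1≤M , K/δ<M) = M ⁻¹ , ⁻¹-pos 0<M , ≤-trans (≤-reflexive (sym (*-identityˡ _)))
      (/-≤ 0<M (≤-trans 1≤M (≤-reflexive (sym (*-identityˡ M))))) , /-< 0<M (begin-strict
        K          ≈⟨ *⁻¹-cancelʳ 0<δ ⟨
        K / δ * δ  <⟨ *-monoˡ-< 0<δ (<-≤-trans (x<1+x _) K/δ<M) ⟩
        M * δ      ≈⟨ *-comm M δ ⟩
        δ * M      ∎)
      where
      0<M : 0# < M
      0<M = 1≤⇒0< 1≤M

  minimum-pos : ∀ {x y} → 0# < x → 0# < y → ∃ λ z → 0# < z × z ≤ x × z ≤ y
  minimum-pos {x} {y} 0<x 0<y =
    [ (λ x≤y → x , 0<x , ≤-refl , x≤y) , (λ y≤x → y , 0<y , y≤x , ≤-refl) ]′ (≤-total x y)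

  -- With c S = A y the requirement c S t / X ≈ y becomes A t ≈ X, in which all quantities are
  -- positive. S is the sign of c / y and A its absolute value.
  sign-factor : ∀ {c y} → c ≉ 0# → y ≉ 0# → ∃ λ S → IsSign S × ∃ λ A → 0# < A × c * S ≈ A * y
  sign-factor {c} {y} c≉0 y≉0 = cases (compare w 0#)
    where
    w : Carrier
    w = c / y
    wy≈c : w * y ≈ c
    wy≈c = trans (*-assoc _ _ _) (trans (*-congˡ (trans (*-comm _ _) (⁻¹-inverseʳ y≉0))) (*-identityʳ c))
    cases : Tri (w < 0#) (w ≈ 0#) (0# < w) → ∃ λ S → IsSign S × ∃ λ A → 0# < A × c * S ≈ A * y
    cases (tri< w<0 _ _) = - 1# , inj₂ refl , - w , neg⇒0<- w<0 ,
      trans (*-congʳ (sym wy≈c)) (solve 2 (λ w y → w :* y :* :- :1 := :- w :* y) refl w y)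
    cases (tri≈ _ w≈0 _) = contradiction (trans (sym wy≈c) (trans (*-congʳ w≈0) (zeroˡ y))) c≉0
    cases (tri> _ _ 0<w) = 1# , inj₁ refl , w , 0<w , trans (*-identityʳ c) (sym wy≈c)

  -- The lower bound needs 1 / (1 + ε) ≥ 1 - ε, that is (1 + ε)(1 - ε) ≤ 1.
  ratio-error : ∀ {ε a X} → 0# ≤ ε → 0# < X → a ≤ (1# + ε) * X → X ≤ (1# + ε) * a → ∣ a / X - 1# ∣ ≤ ε
  ratio-error {ε} {a} {X} 0≤ε 0<X a≤τX X≤τa = ∣x∣≤
    (≤-by (x≤y⇒0≤y-x (/-≤ 0<X a≤τX)) (solve 2 (λ ε W → ε :- (W :- :1) := :1 :+ ε :- W) refl ε W))
    (≤-by (x≤y⇒0≤y-x 1-ε≤W) (solve 2 (λ ε W → ε :- :- (W :- :1) := W :- (:1 :- ε)) refl ε W))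
    where
    W : Carrier
    W = a / X
    1≤τW : 1# ≤ (1# + ε) * W
    1≤τW = *-cancelʳ-≤ 0<X (begin
      1# * X                ≈⟨ *-identityˡ X ⟩
      X                     ≤⟨ X≤τa ⟩
      (1# + ε) * a          ≈⟨ *-congˡ (*⁻¹-cancelʳ 0<X) ⟨
      (1# + ε) * (W * X)    ≈⟨ *-assoc _ _ _ ⟨
      (1# + ε) * W * X      ∎)
    1-ε≤W : 1# - ε ≤ W
    1-ε≤W = *-cancelˡ-≤ {z = 1# + ε} (+-pos-nonneg 0<1 0≤ε) (≤-trans
      (≤-by (*-nonneg 0≤ε 0≤ε) (solve 1 (λ ε → :1 :- (:1 :+ ε) :* (:1 :- ε) := ε :* ε) refl ε)) 1≤τW)

  -- Errors relative to the target are useless for the target 0. It is reached through δ / 2,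
  -- approximated to within δ / 2.
  dense-from-nonzero : {I : Set} (a : I → Carrier) →
    (∀ y → y ≉ 0# → ∀ δ → 0# < δ → ∃ λ i → ∣ a i - y ∣ < δ) → Dense a
  dense-from-nonzero a near-nonzero y δ 0<δ with y ≟ 0#
  ... | no y≉0  = near-nonzero y y≉0 δ 0<δ
  ... | yes y≈0 = shifted (near-nonzero h (0<⇒≉0 0<h) h 0<h)
    where
    h : Carrier
    h = δ / 2#
    0<h : 0# < h
    0<h = *-pos 0<δ (⁻¹-pos 0<2)
    shifted : (∃ λ i → ∣ a i - h ∣ < h) → ∃ λ i → ∣ a i - y ∣ < δ
    shifted (i , near) = i , (begin-strict
      ∣ a i - y ∣          ≈⟨ ∣-∣-cong (+-congˡ (trans (-‿cong y≈0) -0≈0)) ⟩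
      ∣ a i + 0# ∣         ≈⟨ ∣-∣-cong (solve 2 (λ a h → a :+ con (+ 0) := (a :- h) :+ h) refl (a i) h) ⟩
      ∣ (a i - h) + h ∣    ≤⟨ ∣x+y∣≤∣x∣+∣y∣ _ _ ⟩
      ∣ a i - h ∣ + ∣ h ∣  <⟨ +-monoˡ-< ∣ h ∣ near ⟩
      h + ∣ h ∣            ≈⟨ +-congˡ (0≤x⇒∣x∣≈x (<⇒≤ 0<h)) ⟩
      h + h                ≈⟨ solve 1 (λ h → h :+ h := h :* :2) refl h ⟩
      h * 2#               ≈⟨ *⁻¹-cancelʳ 0<2 ⟩
      δ                    ∎)

  module _
    {α β : Carrier} (irrational : Irrational α) (0<β : 0# < β)
    (g : Func ℝ⁺ ℝ⁺) (g-asymptotic : (λ t → g ⟨ t ⟩⁺ - proj₁ t ^ʳ β) =o[t→+∞] (λ t → proj₁ t ^ʳ β))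
    (F : Func setoid setoid) (periodic : 1-Periodic F)
    {r γ c : Carrier} (β<γ : β < γ) (c≉0 : c ≉ 0#)
    (F-asymptotic : (λ x → F ⟨ r + x ⟩ - c * sgn x * ∣ x ∣ ^ʳ γ) =o[x→0] (λ x → ∣ x ∣ ^ʳ γ))
    where

    near-nonzero : ∀ y → y ≉ 0# → ∀ δ → 0# < δ →
      ∃ λ (k : ℕ⁺) → ∣ g ⟨ fromℕ⁺ k ⟩⁺ * F ⟨ fromℕ (proj₁ k) * α ⟩ - y ∣ < δ
    near-nonzero y y≉0 δ 0<δ = choose-ε (small-factor (8# * ∣ y ∣) 0<δ) (sign-factor c≉0 y≉0)
      where
      Goal : Set
      Goal = ∃ λ (k : ℕ⁺) → ∣ g ⟨ fromℕ⁺ k ⟩⁺ * F ⟨ fromℕ (proj₁ k) * α ⟩ - y ∣ < δ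

      0<∣c∣ : 0# < ∣ c ∣
      0<∣c∣ = [ (λ 0<∣c∣ → 0<∣c∣) , (λ 0≈∣c∣ → contradiction (c≈0 0≈∣c∣) c≉0) ]′ (0≤∣x∣ c)
        where
        c≈0 : 0# ≈ ∣ c ∣ → c ≈ 0#
        c≈0 0≈∣c∣ = ≤-antisym (≤-trans (x≤∣x∣ c) (≤-reflexive (sym 0≈∣c∣)))
          (≤-by (x≤y⇒0≤y-x (≤-trans (-x≤∣x∣ c) (≤-reflexive (sym 0≈∣c∣))))
                (solve 1 (λ c → c :- con (+ 0) := con (+ 0) :- :- c) refl c))

      choose-ε : (∃ λ ε → 0# < ε × ε ≤ 1# × 8# * ∣ y ∣ * ε < δ) →
        (∃ λ S → IsSign S × ∃ λ A → 0# < A × c * S ≈ A * y) → Goal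
      choose-ε (ε , 0<ε , ε≤1 , 8yε<δ) (S , S-sign , A , 0<A , cS≈Ay) =
        -- The error of F is given relative to ∣x∣ᵞ, but `product-error` wants it relative to c
        -- sgn(x) ∣x∣ᵞ; hence the factor ∣c∣.
        choose-scales (g-asymptotic ε 0<ε) (F-asymptotic (ε * ∣ c ∣) (*-pos 0<ε 0<∣c∣))
        where
        choose-scales :
          (∃ λ T → ∀ t → T < proj₁ t → ∣ g ⟨ t ⟩⁺ - proj₁ t ^ʳ β ∣ ≤ ε * ∣ proj₁ t ^ʳ β ∣) →
          (∃ λ η → 0# < η × (∀ x → 0# < ∣ x ∣ → ∣ x ∣ < η →
            ∣ F ⟨ r + x ⟩ - c * sgn x * ∣ x ∣ ^ʳ γ ∣ ≤ ε * ∣ c ∣ * ∣ ∣ x ∣ ^ʳ γ ∣)) → Goal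
        -- Capping η at 1 forces ∣x∣ < 1, where `_^ʳ_` is the reciprocal of a power of 1/∣x∣ ≥ 1.
        choose-scales (T , g-near) (η₀ , 0<η₀ , F-near) = choose-η (minimum-pos 0<η₀ 0<1)
          where
          choose-η : (∃ λ η → 0# < η × η ≤ η₀ × η ≤ 1#) → Goal
          choose-η (η , 0<η , η≤η₀ , η≤1) = conclude
            (hit-exists {r = r} {T = T} irrational S-sign 0<A 0<β β<γ 1<1+ε 0<η η≤1)
            where
            1<1+ε : 1# < 1# + ε
            1<1+ε = <-by 0<ε (solve 1 (λ ε → :1 :+ ε :- :1 := ε) refl ε)

            conclude : Hit α r S A β γ (1# + ε) η T → Goal
            conclude (hit zero _ _ _ () _ _ _ _)
            conclude (hit (suc n) m x kα≈ _ T<k 0<Sx ∣x∣<η balanced) =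
              (suc n , _) , ≤-<-trans (product-error (<⇒≤ 0<ε) ε≤1 (g-near (fromℕ⁺ (suc n , _)) T<k) f-u tu-y) 8yε<δ
              where
              k t u p : Carrier
              k = fromℕ (suc n)
              t = k ^ʳ β
              p = ∣ x ∣ ^ʳ γ
              u = c * sgn x * p

              0<∣x∣ : 0# < ∣ x ∣
              0<∣x∣ = 0<Sx⇒0<∣x∣ S-sign 0<Sx

              Fkα≈ : F ⟨ k * α ⟩ ≈ F ⟨ r + x ⟩
              Fkα≈ = trans (Func.cong F kα≈) (periodic-ℤ F periodic m (r + x))

              ∣u∣≈ : ∣ u ∣ ≈ ∣ c ∣ * ∣ p ∣
              ∣u∣≈ = begin-equality
                ∣ c * sgn x * p ∣      ≈⟨ ∣-∣-cong (*-congʳ (*-congˡ (sgn-unique S-sign 0<Sx))) ⟩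
                ∣ c * S * p ∣          ≈⟨ ∣-∣-cong (solve 3 (λ c S p → c :* S :* p := S :* (c :* p)) refl c S p) ⟩
                ∣ S * (c * p) ∣        ≈⟨ ∣S*x∣≈∣x∣ S-sign _ ⟩
                ∣ c * p ∣              ≈⟨ ∣x*y∣≈∣x∣*∣y∣ c p ⟩
                ∣ c ∣ * ∣ p ∣          ∎

              f-u : ∣ F ⟨ k * α ⟩ - u ∣ ≤ ε * ∣ u ∣
              f-u = begin
                ∣ F ⟨ k * α ⟩ - u ∣    ≈⟨ ∣-∣-cong (+-congʳ Fkα≈) ⟩
                ∣ F ⟨ r + x ⟩ - u ∣    ≤⟨ F-near x 0<∣x∣ (<-≤-trans ∣x∣<η η≤η₀) ⟩
                ε * ∣ c ∣ * ∣ p ∣      ≈⟨ trans (*-assoc _ _ _) (*-congˡ (sym ∣u∣≈)) ⟩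
                ε * ∣ u ∣              ∎

              tu-y : ∣ t * u - y ∣ ≤ ε * ∣ y ∣
              tu-y = from-power (^ʳ-isPow-⁻¹ 0<∣x∣ (<-≤-trans ∣x∣<η η≤1) (<⇒≤ (<-trans 0<β β<γ)))
                where
                t-pow : IsPow k β t
                t-pow = ^ʳ-isPow (1≤fromℕ {suc n} (ℕ.s≤s ℕ.z≤n)) (<⇒≤ 0<β)
                from-power : (∃ λ X → IsPow (∣ x ∣ ⁻¹) γ X × p ≈ X ⁻¹) → ∣ t * u - y ∣ ≤ ε * ∣ y ∣
                from-power (X , X-pow , p≈X⁻¹) = begin
                  ∣ t * u - y ∣                    ≈⟨ ∣-∣-cong (+-congʳ tu≈) ⟩
                  ∣ y * (A * t / X) - y ∣          ≈⟨ ∣-∣-cong (solve 2 (λ y W → y :* W :- y := y :* (W :- :1))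
                                                        refl y (A * t / X)) ⟩
                  ∣ y * (A * t / X - 1#) ∣         ≈⟨ ∣x*y∣≈∣x∣*∣y∣ _ _ ⟩
                  ∣ y ∣ * ∣ A * t / X - 1# ∣       ≤⟨ *-monoʳ-≤ (0≤∣x∣ y) (ratio-error (<⇒≤ 0<ε) 0<X
                                                        (proj₁ (balanced t-pow X-pow)) (proj₂ (balanced t-pow X-pow))) ⟩
                  ∣ y ∣ * ε                        ≈⟨ *-comm _ _ ⟩
                  ε * ∣ y ∣                        ∎
                  where
                  0<X : 0# < X
                  0<X = 1≤⇒0< (isPow-1≤ (<⇒≤ (<-trans 0<β β<γ)) X-pow)
                  tu≈ : t * u ≈ y * (A * t / X)
                  tu≈ = begin-equality
                    t * (c * sgn x * p)       ≈⟨ *-congˡ (*-cong (*-congˡ (sgn-unique S-sign 0<Sx)) p≈X⁻¹) ⟩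
                    t * (c * S * X ⁻¹)        ≈⟨ *-congˡ (*-congʳ cS≈Ay) ⟩
                    t * (A * y * X ⁻¹)        ≈⟨ solve 4 (λ t A y X → t :* (A :* y :* X) := y :* (A :* t :* X))
                                                   refl t A y (X ⁻¹) ⟩
                    y * (A * t / X)           ∎

    dense : Dense (λ (k : ℕ⁺) → g ⟨ fromℕ⁺ k ⟩⁺ * F ⟨ fromℕ (proj₁ k) * α ⟩)
    dense = dense-from-nonzero (λ k → g ⟨ fromℕ⁺ k ⟩⁺ * F ⟨ fromℕ (proj₁ k) * α ⟩) near-nonzero

  x/y<1⇒x<y : ∀ {x y} → 0# < y → x / y < 1# → x < y
  x/y<1⇒x<y {x} {y} 0<y x/y<1 = begin-strict
    x          ≈⟨ *⁻¹-cancelʳ 0<y ⟨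
    x / y * y  <⟨ *-monoˡ-< 0<y x/y<1 ⟩
    1# * y     ≈⟨ *-identityˡ y ⟩
    y          ∎

corollary2 : (em : ExcludedMiddle 0ℓ) (ℝ : CompleteOrderedField) →
  let open RealAnalysis em ℝ in
  (α : Carrier) → Irrational α →
  (β : Carrier) → 0# < β →
  (g : Func ℝ⁺ ℝ⁺) →
  (λ t → g ⟨ t ⟩⁺ - proj₁ t ^ʳ β) =o[t→+∞] (λ t → proj₁ t ^ʳ β) →
  (F : Func setoid setoid) →
  Continuous F → 1-Periodic F → OnlyIsolatedRoots F →
  (γ c : ∀ r → Root F r → Carrier) →
  (∀ r (ρ : Root F r) → 0# < γ r ρ × c r ρ ≉ 0# ×
    (λ x → F ⟨ r + x ⟩ - c r ρ * sgn x * ∣ x ∣ ^ʳ γ r ρ) =o[x→0] (λ x → ∣ x ∣ ^ʳ γ r ρ)) →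
  (∃ λ r → ∃ λ (ρ : Root F r) → 0# < β / γ r ρ × β / γ r ρ < 1#) →
  Dense (λ (k : ℕ⁺) → g ⟨ fromℕ⁺ k ⟩⁺ * F ⟨ fromℕ (proj₁ k) * α ⟩)
corollary2 em ℝ α irrational β 0<β g g-asymptotic F _ periodic _ γ c local (r , ρ , _ , β/γ<1) =
  dense irrational 0<β g g-asymptotic F periodic (x/y<1⇒x<y 0<γ β/γ<1) c≉0 F-asymptotic
  where
  open RealAnalysis em ℝ
  open DensityProof em ℝ
  0<γ : 0# < γ r ρ
  0<γ = proj₁ (local r ρ)
  c≉0 : c r ρ ≉ 0#
  c≉0 = proj₁ (proj₂ (local r ρ))
  F-asymptotic : (λ x → F ⟨ r + x ⟩ - c r ρ * sgn x * ∣ x ∣ ^ʳ γ r ρ) =o[x→0] (λ x → ∣ x ∣ ^ʳ γ r ρ)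
  F-asymptotic = proj₂ (proj₂ (local r ρ))
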